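{- There exists $n_0$ such that for every $n \ge n_0$ the following holds. Let $t=\frac{1}{4}n^{1/3}$ (rounded to an integer). Let $T_1,T_2,\dots,T_t$ be trees such that for each $i\in\{1,\dots,t\}$ we have $|T_i| = n-i+1$ and at least one of the following holds: (1) $T_i$ has a set of at most $n^{1/3}$ vertices such that the union of their neighborhoods contains at least $n^{2/3}$ leaves of $T_i$; (2) $T_i$ has at least $n^{2/3}$ independent leaves. Then $T_1,T_2,\dots,T_t$ pack into the complete graph $K_n$.
   Context: $|T|$ denotes the number of vertices of $T$. A set of graphs $G_1,\dots,G_m$ packs into a graph $H$ if $G_1,\dots,G_m$ can be found as pairwise edge-disjoint subgraphs of $H$. A leaf is a vertex of degree $1$. A set of leaves is independent if the neighbors of the leaves are pairwise distinct (i.e. the edges incident to these leaves form a matching). The neighborhood of a set $X$ of vertices is the set of vertices not in $X$ having a neighbor in $X$. The paper suppresses integer-part notation, so quantities such as $\frac14 n^{1/3}$ are understood as integers. -}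

module Defs where

open import Data.Fin using (Fin; _≟_)
open import Data.Fin.Subset using (Subset; _∈_; ∣_∣)
open import Data.List using (List; _∷_; _++_; length; [_])
open import Data.List.Relation.Unary.Linked using (Linked)
open import Data.List.Relation.Unary.Unique.Propositional using (Unique)
open import Data.Nat using (ℕ; _≤_; _<_; _*_; _^_; suc)
open import Data.Product using (_×_; ∃; ∃₂; ∃-syntax)
open import Data.Vec using (tabulate)
open import Function using (_∘_)
open import Function.Definitions using (Injective)
open import Level using (0ℓ)
open import Relation.Binary using (Rel; Symmetric; Irreflexive; Decidable)
open import Relation.Binary.Construct.Closure.ReflexiveTransitive using (Star)
open import Relation.Binary.PropositionalEquality using (_≡_; _≢_; sym)
open import Relation.Nullary using (¬_; does; ¬?)

-- Finite simple graphs.  Adjacency is decidable, so that degrees can be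
-- counted; classically this is no restriction.

record Graph (n : ℕ) : Set₁ where
  field
    Adj    : Rel (Fin n) 0ℓ
    adj?   : Decidable Adj
    symm   : Symmetric Adj
    irrefl : Irreflexive _≡_ Adj

  neighborhood : Fin n → Subset n
  neighborhood v = tabulate (λ w → does (adj? v w))

  degree : Fin n → ℕ
  degree v = ∣ neighborhood v ∣

  Leaf : Fin n → Set
  Leaf v = degree v ≡ 1

  Connected : Set
  Connected = ∀ u v → Star Adj u v

  IsCycle : Fin n → List (Fin n) → Set
  IsCycle v vs = 2 ≤ length vs × Unique (v ∷ vs) × Linked Adj (v ∷ vs ++ [ v ])

  Acyclic : Set
  Acyclic = ∀ v vs → ¬ IsCycle v vs

  record IsTree : Set where
    field
      nonEmpty  : 0 < n
      connected : Connected
      acyclic   : Acyclic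

  LeavesInNeighborhoods : Subset n → Subset n → Set
  LeavesInNeighborhoods X L =
    ∀ {v} → v ∈ L → Leaf v × (∃[ x ] (x ∈ X × v ∈ neighborhood x))

  IndependentLeaves : Subset n → Set
  IndependentLeaves L =
    (∀ {v} → v ∈ L → Leaf v) ×
    (∀ {u v x y} → u ∈ L → v ∈ L → u ≢ v → Adj u x → Adj v y → x ≢ y)

open Graph

complete : ∀ n → Graph n
complete n = record
  { Adj    = _≢_
  ; adj?   = λ u v → ¬? (u ≟ v)
  ; symm   = λ u≢v → u≢v ∘ sym
  ; irrefl = λ u≡v u≢v → u≢v u≡v
  }

-- A copy of G as a (not necessarily induced) subgraph of H.

record Embedding {m n} (G : Graph m) (H : Graph n) : Set where
  field
    to        : Fin m → Fin n
    injective : Injective _≡_ _≡_ to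
    preserves : ∀ {u v} → Adj G u v → Adj H (to u) (to v)

  ImageAdj : Rel (Fin n) 0ℓ
  ImageAdj a b = ∃₂ λ u v → Adj G u v × to u ≡ a × to v ≡ b

open Embedding

EdgeDisjoint : ∀ {k m n} {G : Graph k} {G′ : Graph m} {H : Graph n} →
               Embedding G H → Embedding G′ H → Set
EdgeDisjoint f g = ∀ a b → ¬ (ImageAdj f a b × ImageAdj g a b)

Packs : ∀ {t n} {size : Fin t → ℕ} →
        ((i : Fin t) → Graph (size i)) → Graph n → Set
Packs {t} G H =
  ∃ λ (f : (i : Fin t) → Embedding (G i) H) →
    ∀ i j → i ≢ j → EdgeDisjoint (f i) (f j)

-- t = ⌊ n^{1/3} / 4 ⌋.

IsQuarterCubeRoot : ℕ → ℕ → Set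
IsQuarterCubeRoot n t = (4 * t) ^ 3 ≤ n × n < (4 * suc t) ^ 3

-- Below, |X| ≤ n^{1/3} is written |X|³ ≤ n and |L| ≥ n^{2/3} is written
-- n² ≤ |L|³.  The parameter n is not the number of vertices of G.

ManyLeavesNearFew : ℕ → ∀ {m} → Graph m → Set
ManyLeavesNearFew n {m} G =
  ∃₂ λ (X L : Subset m) →
    ∣ X ∣ ^ 3 ≤ n × n ^ 2 ≤ ∣ L ∣ ^ 3 × LeavesInNeighborhoods G X L

ManyIndependentLeaves : ℕ → ∀ {m} → Graph m → Set
ManyIndependentLeaves n {m} G =
  ∃ λ (L : Subset m) → n ^ 2 ≤ ∣ L ∣ ^ 3 × IndependentLeaves G L

{-# OPTIONS --safe #-}

-- Embed the trees one after the other, T_j avoiding the union U of its predecessors.  Host j is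
-- used by the earlier trees only for leaves, so that it has at most j edges in U.  The leaves
-- supplied by the hypothesis are withheld; let P be the set of their parents, and close P under
-- adding vertices with two children in the set.  The resulting core has at most 2|P| vertices,
-- and every other vertex has at most one child in it.  The core is placed top-down on hosts of
-- U-degree at most 4(t − 1), then the remaining non-leaves top-down on hosts with at most 8t²
-- children in U.  About r/2 hosts, r being the number of withheld leaves, fail the latter condition,
-- since U has at most jn edges directed from child to parent; this is where the constant 1/4 comes
-- from.  Finally the withheld leaves go to unused hosts, conflicts being removed by exchanging two
-- leaves.  The exchange needs every remaining host to be non-adjacent to the parents of more than
-- 4(t − 1) withheld leaves.  If few vertices carry all the leaves, then one vertex x carries that
-- many, and x is placed at host j, whose U-neighbours are omitted.  If the leaves are independent,
-- then all but at most j hosts, which are omitted, have many non-neighbours of low degree; at most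
-- 8(t − 1) of the others are adjacent to most of the first 8t − 7 parents, and these receive leaves
-- whose parents are placed away from them in advance.

module Submission where

open import Data.Bool using (true; false)
open import Data.Empty using (⊥-elim)
open import Data.Fin using (Fin; zero; suc; toℕ)
open import Data.Fin.Permutation.Components using (transpose; transpose-inverse)
open import Data.List
  using (List; []; _∷_; _++_; [_]; length; map; filter; concatMap; mapMaybe; allFin; take; upTo)
open import Data.List.Membership.Propositional using (_∈_; _∉_; find; lose)
open import Data.List.Membership.Propositional.Properties
  using (∈-∃++; ∈-++⁺ˡ; ∈-++⁺ʳ; ∈-++⁻; ∈-filter⁺; ∈-filter⁻; ∈-map⁺; ∈-map⁻; ∈-allFin; ∈-upTo⁺;
         ∈-concatMap⁺; ∈-concatMap⁻)
open import Data.List.Properties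
  using (length-++; length-++-sucʳ; length-++-≤ʳ; ++-identityʳ; length-mapMaybe; length-map;
         length-tabulate; length-take; length-filter; length-upTo; filter-++; filter-all; filter-none;
         filter-accept; filter-reject)
open import Data.List.Relation.Unary.All using (All; []; _∷_)
open import Data.List.Relation.Unary.AllPairs using (AllPairs; []; _∷_)
open import Data.List.Relation.Unary.Any using (Any; here; there; any?)
open import Data.List.Relation.Unary.Linked using (Linked; [-]; _∷_)
open import Data.List.Relation.Unary.Unique.Propositional using (Unique)
open import Data.Maybe using (Maybe; just; nothing; fromMaybe)
open import Data.Maybe.Properties using (≡-dec; just-injective)
open import Data.Nat
open import Data.Nat.DivMod using (m≡m%n+[m/n]*n; m%n<n)
open import Data.Nat.Properties
open import Data.Nat.Tactic.RingSolver using (solve-∀)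
open import Data.Product using (∃; ∃-syntax; _×_; _,_; proj₁; proj₂)
open import Data.Sum using (_⊎_; inj₁; inj₂; fromInj₂)
open import Data.Vec using ([]; _∷_)
open import Defs
open import Function using (_∘_; id; const)
open import Level using (0ℓ)
open import Relation.Binary using (DecidableEquality)
open import Relation.Binary.Construct.Closure.ReflexiveTransitive using (Star; ε; _◅_)
open import Relation.Binary.PropositionalEquality hiding ([_])
open import Relation.Nullary using (¬_; Dec; yes; no; ¬?; does)
open import Relation.Nullary.Decidable using (_×-dec_; dec-true; decidable-stable)
open import Relation.Unary using (Pred; Decidable)
import Data.Fin as Fin
import Data.Fin.Properties as Fin
import Data.Fin.Subset as Subset
import Data.List.Relation.Unary.All as All
import Data.List.Relation.Unary.AllPairs.Properties as AllPairs
import Data.List.Relation.Unary.Any as Any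
import Data.List.Relation.Unary.Unique.Propositional.Properties as Unique
import Data.Maybe as Maybe
import Data.Vec as Vec
import Data.Vec.Properties as Vec

private variable
  A B : Set
  n k : ℕ

-- Counting and pigeonhole arguments for lists.

module _ {P : Pred A 0ℓ} (P? : Decidable P) where

  length-filter-filter¬ : ∀ xs → length (filter P? xs) + length (filter (¬? ∘ P?) xs) ≡ length xs
  length-filter-filter¬ [] = refl
  length-filter-filter¬ (x ∷ xs) with P? x
  ... | yes _ = cong suc (length-filter-filter¬ xs)
  ... | no _ = trans (+-suc _ _) (cong suc (length-filter-filter¬ xs))

  -- Removing entries from the front lowers the number of hits by at most one at a time, so the
  -- value `k` is attained. This later cuts the core so that the part placed first contains a
  -- prescribed number of parents.
  filter-split : ∀ k xs → k ≤ length (filter P? xs) →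
    ∃[ ys ] ∃[ zs ] (xs ≡ ys ++ zs × length (filter P? zs) ≡ k)
  filter-split zero [] _ = [] , [] , refl , refl
  filter-split k (x ∷ xs) k≤ with k ≤? length (filter P? xs)
  ... | yes k≤′ with filter-split k xs k≤′
  ...   | ys , zs , refl , eq = x ∷ ys , zs , refl , eq
  filter-split k (x ∷ xs) k≤ | no k≰ with P? x in eq
  ... | yes px = [] , x ∷ xs , refl ,
        trans (cong length (filter-accept P? {xs = xs} px)) (≤-antisym (≰⇒> k≰) k≤)
  ... | no _ = ⊥-elim (k≰ k≤)

length-concatMap-≤ : ∀ {m} (f : A → List B) xs → (∀ {x} → x ∈ xs → length (f x) ≤ m) →
  length (concatMap f xs) ≤ length xs * m
length-concatMap-≤ f [] _ = z≤n
length-concatMap-≤ f (x ∷ xs) f≤ = ≤-trans (≤-reflexive (length-++ (f x)))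
  (+-mono-≤ (f≤ (here refl)) (length-concatMap-≤ f xs (f≤ ∘ there)))

⊆-length : {xs ys : List A} → Unique xs → (∀ {x} → x ∈ xs → x ∈ ys) → length xs ≤ length ys
⊆-length [] _ = z≤n
⊆-length {xs = x ∷ xs} (x# ∷ u) sub with ∈-∃++ (sub (here refl))
... | as , bs , refl = ≤-trans (s≤s (⊆-length u sub′)) (≤-reflexive (sym (length-++-sucʳ as x bs)))
  where
  sub′ : ∀ {y} → y ∈ xs → y ∈ as ++ bs
  sub′ y∈ with ∈-++⁻ as (sub (there y∈))
  ... | inj₁ y∈as = ∈-++⁺ˡ y∈as
  ... | inj₂ (here refl) = ⊥-elim (All.lookup x# y∈ refl)
  ... | inj₂ (there y∈bs) = ∈-++⁺ʳ as y∈bs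

module _ {k : ℕ} where
  open import Data.List.Membership.DecPropositional (Fin._≟_ {k}) public using (_∈?_; _∉?_)

module _ {k : ℕ} where

  ∃-missing : {xs ys : List (Fin k)} → Unique xs → length ys < length xs → ∃[ x ] (x ∈ xs × x ∉ ys)
  ∃-missing {xs} {ys} u lt with any? (_∉? ys) xs
  ... | yes p = find p
  ... | no ∄ = ⊥-elim (<⇒≱ lt (⊆-length u sub))
    where
    sub : ∀ {x} → x ∈ xs → x ∈ ys
    sub {x} x∈ with x ∈? ys
    ... | yes x∈ys = x∈ys
    ... | no x∉ys = ⊥-elim (∄ (lose x∈ x∉ys))

  length-allFin : length (allFin k) ≡ k
  length-allFin = length-tabulate id

  Unique⇒length≤ : {xs : List (Fin k)} → Unique xs → length xs ≤ k
  Unique⇒length≤ u = ≤-trans (⊆-length u (λ _ → ∈-allFin _)) (≤-reflexive length-allFin)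

  cover-length : (xs ys : List (Fin k)) → (∀ x → x ∈ xs ⊎ x ∈ ys) → k ≤ length xs + length ys
  cover-length xs ys cover = ≤-trans (≤-reflexive (sym length-allFin))
    (≤-trans (⊆-length (Unique.allFin⁺ k) (λ {x} _ → cov (cover x))) (≤-reflexive (length-++ xs)))
    where
    cov : ∀ {x} → x ∈ xs ⊎ x ∈ ys → x ∈ xs ++ ys
    cov (inj₁ p) = ∈-++⁺ˡ p
    cov (inj₂ p) = ∈-++⁺ʳ xs p

  count : Fin k → List (Fin k) → ℕ
  count v xs = length (filter (v Fin.≟_) xs)

  count-++ : ∀ v xs ys → count v (xs ++ ys) ≡ count v xs + count v ys
  count-++ v xs ys = trans (cong length (filter-++ (v Fin.≟_) xs ys)) (length-++ (filter (v Fin.≟_) xs))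

  count-delete : ∀ {v w} xs → w ≢ v → count w (filter (¬? ∘ (v Fin.≟_)) xs) ≡ count w xs
  count-delete [] _ = refl
  count-delete {v} {w} (x ∷ xs) w≢v with v Fin.≟ x
  ... | yes refl with w Fin.≟ v
  ...   | yes w≡v = ⊥-elim (w≢v w≡v)
  ...   | no _ = count-delete xs w≢v
  count-delete {v} {w} (x ∷ xs) w≢v | no _ with w Fin.≟ x
  ...   | yes _ = cong suc (count-delete xs w≢v)
  ...   | no _ = count-delete xs w≢v

  -- Double counting: the occurrences of `v` are removed before the recursion, which leaves the
  -- counts of the other values in `vs` unchanged.
  markov : ∀ m {vs} xs → Unique vs → (∀ {v} → v ∈ vs → m ≤ count v xs) → length vs * m ≤ length xs
  markov m xs [] _ = z≤n
  markov m {v ∷ vs} xs (v# ∷ u) m≤ = ≤-trans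
    (+-mono-≤ (m≤ (here refl))
      (markov m (filter (¬? ∘ (v Fin.≟_)) xs) u (λ w∈ → ≤-trans (m≤ (there w∈))
        (≤-reflexive (sym (count-delete xs (λ w≡v → All.lookup v# w∈ (sym w≡v))))))))
    (≤-reflexive (length-filter-filter¬ (v Fin.≟_) xs))

  count-pair : (f : A → Maybe (Fin k)) {v : Fin k} {x y : A} (xs : List A) →
    x ∈ xs → y ∈ xs → x ≢ y → f x ≡ just v → f y ≡ just v → 2 ≤ count v (mapMaybe f xs)
  count-pair f {v} {x} {y} xs x∈ y∈ x≢y fx fy = go xs x∈ y∈
    where
    one : ∀ {z} zs → z ∈ zs → f z ≡ just v → 1 ≤ count v (mapMaybe f zs)
    one (z ∷ zs) (here refl) fz rewrite fz with v Fin.≟ v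
    ... | yes _ = s≤s z≤n
    ... | no v≢v = ⊥-elim (v≢v refl)
    one (z ∷ zs) (there z∈) fz with f z
    ... | nothing = one zs z∈ fz
    ... | just a with v Fin.≟ a
    ...   | yes _ = s≤s z≤n
    ...   | no _ = one zs z∈ fz
    two : ∀ {z w} zs → z ≡ w → f w ≡ just v → 1 ≤ count v (mapMaybe f zs) → 2 ≤ count v (mapMaybe f (z ∷ zs))
    two zs refl fz le rewrite fz with v Fin.≟ v
    ... | yes _ = s≤s le
    ... | no v≢v = ⊥-elim (v≢v refl)
    go : ∀ zs → x ∈ zs → y ∈ zs → 2 ≤ count v (mapMaybe f zs)
    go (z ∷ zs) (here refl) (here refl) = ⊥-elim (x≢y refl)
    go (z ∷ zs) (here refl) (there y∈) = two zs refl fx (one zs y∈ fy)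
    go (z ∷ zs) (there x∈) (here refl) = two zs refl fy (one zs x∈ fx)
    go (z ∷ zs) (there x∈) (there y∈) with f z
    ... | nothing = go zs x∈ y∈
    ... | just a with v Fin.≟ a
    ...   | yes _ = m≤n⇒m≤1+n (go zs x∈ y∈)
    ...   | no _ = go zs x∈ y∈

  length≤1 : {xs : List (Fin k)} → Unique xs → (∀ {x y} → x ∈ xs → y ∈ xs → x ≡ y) → length xs ≤ 1
  length≤1 {[]} _ _ = z≤n
  length≤1 {x ∷ []} _ _ = s≤s z≤n
  length≤1 {x ∷ y ∷ xs} ((x≢y ∷ _) ∷ _) eq = ⊥-elim (x≢y (eq (here refl) (there (here refl))))

  ∃-large-fibre : (f : A → Fin k) (m : ℕ) (ps : List (Fin k)) (xs : List A) → (∀ {x} → x ∈ xs → f x ∈ ps) →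
    length ps * m < length xs → ∃[ p ] (p ∈ ps × m < length (filter (λ x → f x Fin.≟ p) xs))
  ∃-large-fibre f m ps xs f∈ lt with any? (λ p → m <? length (filter (λ x → f x Fin.≟ p) xs)) ps
  ... | yes w = find w
  ... | no ∄ = ⊥-elim (<⇒≱ lt (go ps xs f∈ (λ p∈ → ≮⇒≥ (λ m< → ∄ (lose p∈ m<)))))
    where
    monotone : ∀ q p xs → length (filter (λ x → f x Fin.≟ p) (filter (¬? ∘ (λ x → f x Fin.≟ q)) xs))
      ≤ length (filter (λ x → f x Fin.≟ p) xs)
    monotone q p [] = z≤n
    monotone q p (x ∷ xs) with f x Fin.≟ q
    ... | no _ with f x Fin.≟ p
    ...   | yes _ = s≤s (monotone q p xs)
    ...   | no _ = monotone q p xs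
    monotone q p (x ∷ xs) | yes _ with f x Fin.≟ p
    ...   | yes _ = m≤n⇒m≤1+n (monotone q p xs)
    ...   | no _ = monotone q p xs
    go : ∀ ps xs → (∀ {x} → x ∈ xs → f x ∈ ps) →
      (∀ {p} → p ∈ ps → length (filter (λ x → f x Fin.≟ p) xs) ≤ m) → length xs ≤ length ps * m
    go [] [] _ _ = z≤n
    go [] (x ∷ xs) f∈ _ with f∈ (here refl)
    ... | ()
    go (p ∷ ps) xs f∈ ≤m = ≤-trans (≤-reflexive (sym (length-filter-filter¬ (λ x → f x Fin.≟ p) xs)))
      (+-mono-≤ (≤m (here refl)) (go ps _ f∈′ (λ q∈ → ≤-trans (monotone p _ xs) (≤m (there q∈)))))
      where
      f∈′ : ∀ {x} → x ∈ filter (¬? ∘ (λ x → f x Fin.≟ p)) xs → f x ∈ ps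
      f∈′ x∈ with ∈-filter⁻ (¬? ∘ (λ x → f x Fin.≟ p)) {xs = xs} x∈
      ... | x∈xs , ≢p with f∈ x∈xs
      ...   | here eq = ⊥-elim (≢p eq)
      ...   | there q∈ = q∈

-- Subsets as lists without repetition, and pointwise updates of functions.

elements : Subset.Subset n → List (Fin n)
elements [] = []
elements (true ∷ p) = zero ∷ map suc (elements p)
elements (false ∷ p) = map suc (elements p)

length-elements : (p : Subset.Subset n) → length (elements p) ≡ Subset.∣ p ∣
length-elements [] = refl
length-elements (true ∷ p) = cong suc (trans (length-map suc (elements p)) (length-elements p))
length-elements (false ∷ p) = trans (length-map suc (elements p)) (length-elements p)

∈-elements⁺ : ∀ {x} {p : Subset.Subset n} → x Subset.∈ p → x ∈ elements p
∈-elements⁺ {p = true ∷ p} Vec.here = here refl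
∈-elements⁺ {p = true ∷ p} (Vec.there x∈) = there (∈-map⁺ suc (∈-elements⁺ x∈))
∈-elements⁺ {p = false ∷ p} (Vec.there x∈) = ∈-map⁺ suc (∈-elements⁺ x∈)

∈-elements⁻ : ∀ {x} {p : Subset.Subset n} → x ∈ elements p → x Subset.∈ p
∈-elements⁻ {p = true ∷ p} (here refl) = Vec.here
∈-elements⁻ {p = true ∷ p} (there x∈) with ∈-map⁻ suc x∈
... | y , y∈ , refl = Vec.there (∈-elements⁻ y∈)
∈-elements⁻ {p = false ∷ p} x∈ with ∈-map⁻ suc x∈
... | y , y∈ , refl = Vec.there (∈-elements⁻ y∈)

elements-unique : (p : Subset.Subset n) → Unique (elements p)
elements-unique [] = []
elements-unique (true ∷ p) =
  All.tabulate (λ x∈ 0≡x → zero∉ (subst (_∈ _) (sym 0≡x) x∈)) ∷ Unique.map⁺ Fin.suc-injective (elements-unique p)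
  where
  zero∉ : zero ∉ map suc (elements p)
  zero∉ z∈ with ∈-map⁻ suc z∈
  ... | _ , _ , ()
elements-unique (false ∷ p) = Unique.map⁺ Fin.suc-injective (elements-unique p)

update : (Fin k → A) → Fin k → A → Fin k → A
update f u h x with x Fin.≟ u
... | yes _ = h
... | no _ = f x

update-≡ : (f : Fin k → A) (u : Fin k) (h : A) → update f u h u ≡ h
update-≡ f u h with u Fin.≟ u
... | yes _ = refl
... | no u≢u = ⊥-elim (u≢u refl)

update-≢ : (f : Fin k → A) {u x : Fin k} (h : A) → x ≢ u → update f u h x ≡ f x
update-≢ f {u} {x} h x≢u with x Fin.≟ u
... | yes x≡u = ⊥-elim (x≢u x≡u)
... | no _ = refl

Link : (Fin k → Maybe (Fin k)) → Fin k → Fin k → Set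
Link π u v = π u ≡ just v ⊎ π v ≡ just u

-- Rooting a tree.

module _ {N : ℕ} (G : Graph N) where
  open Graph G

  -- The vertices are listed so that parents come after their children.
  record Rooting : Set where
    field
      root        : Fin N
      parent      : Fin N → Maybe (Fin N)
      order       : List (Fin N)
      covers      : ∀ u → u ∈ order
      unique      : Unique order
      bottomUp    : AllPairs (λ u v → parent v ≢ just u) order
      rootUnique  : ∀ {u} → parent u ≡ nothing → u ≡ root
      parent⇒adj  : ∀ {u v} → parent u ≡ just v → Adj u v
      adj⇒link    : ∀ {u v} → Adj u v → Link parent u v

  -- The list contains both ends, so that a vertex outside it and adjacent to both ends turns it
  -- directly into the data of `IsCycle`.
  data Path : Fin N → List (Fin N) → Fin N → Set where
    [-] : ∀ {u} → Path u [ u ] u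
    _∷_ : ∀ {u v w ps} → Adj u v → Path v ps w → Path u (u ∷ ps) w

  path-snoc : ∀ {u v w ps} → Path u ps v → Adj v w → Path u (ps ++ [ w ]) w
  path-snoc [-] vw = vw ∷ [-]
  path-snoc (e ∷ p) vw = e ∷ path-snoc p vw

  path-linked : ∀ {u v w ps} → Adj w u → Path u ps v → Linked Adj (w ∷ ps)
  path-linked wu [-] = wu ∷ [-]
  path-linked wu (e ∷ p) = wu ∷ path-linked e p

  path-length : ∀ {u v ps} → u ≢ v → Path u ps v → 2 ≤ length ps
  path-length u≢v [-] = ⊥-elim (u≢v refl)
  path-length u≢v (_ ∷ [-]) = s≤s (s≤s z≤n)
  path-length u≢v (_ ∷ (_ ∷ p)) = s≤s (s≤s z≤n)

  private
    -- The values of `parent` outside `xs` are arbitrary. The simple paths inside `xs` are what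
    -- turns a second neighbour of a new vertex into a cycle, and so shows that every edge is a
    -- parent link.
    record Subtree (xs : List (Fin N)) : Set where
      field
        root        : Fin N
        parent      : Fin N → Maybe (Fin N)
        root∈       : root ∈ xs
        unique      : Unique xs
        bottomUp    : AllPairs (λ u v → parent v ≢ just u) xs
        rootUnique  : ∀ {u} → u ∈ xs → parent u ≡ nothing → u ≡ root
        parent∈     : ∀ {u v} → u ∈ xs → parent u ≡ just v → v ∈ xs
        parent⇒adj  : ∀ {u v} → u ∈ xs → parent u ≡ just v → Adj u v
        adj⇒link    : ∀ {u v} → u ∈ xs → v ∈ xs → Adj u v → Link parent u v
        path        : ∀ {u v} → u ∈ xs → v ∈ xs →
          ∃[ ps ] (Path u ps v × Unique ps × (∀ {x} → x ∈ ps → x ∈ xs))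

    exit : ∀ {xs u v} → u ∈ xs → v ∉ xs → Star Adj u v → ∃[ p ] ∃[ w ] (p ∈ xs × w ∉ xs × Adj w p)
    exit u∈ v∉ ε = ⊥-elim (v∉ u∈)
    exit {xs} {u} u∈ v∉ (_◅_ {j = w} uw walk) with w ∈? xs
    ... | yes w∈ = exit w∈ v∉ walk
    ... | no w∉ = u , w , u∈ , w∉ , symm uw

    module _ (tree : IsTree) where
      open IsTree tree

      -- The new vertex goes to the front of the list. Parents of vertices in `xs` stay in `xs`, so
      -- none of these has `w` as its parent and the order remains bottom-up.
      attach : ∀ {xs p w} → Subtree xs → p ∈ xs → w ∉ xs → Adj w p → Subtree (w ∷ xs)
      attach {xs} {p} {w} S p∈ w∉ wp = record
        { root = root
        ; parent = parent′
        ; root∈ = there root∈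
        ; unique = All.tabulate (λ x∈ w≡x → w∉ (subst (_∈ xs) (sym w≡x) x∈)) ∷ unique
        ; bottomUp = All.tabulate (λ x∈ eq → w∉ (parent∈ x∈ (trans (sym (old x∈)) eq))) ∷ bu xs id bottomUp
        ; rootUnique = λ { (here refl) eq → ⊥-elim (absurd eq)
                         ; (there u∈) eq → rootUnique u∈ (trans (sym (old u∈)) eq) }
        ; parent∈ = λ { (here refl) eq → there (subst (_∈ xs) (just-injective (trans (sym new) eq)) p∈)
                      ; (there u∈) eq → there (parent∈ u∈ (trans (sym (old u∈)) eq)) }
        ; parent⇒adj = λ { (here refl) eq → subst (Adj w) (just-injective (trans (sym new) eq)) wp
                         ; (there u∈) eq → parent⇒adj u∈ (trans (sym (old u∈)) eq) }
        ; adj⇒link = link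
        ; path = path′
        }
        where
        open Subtree S
        parent′ = update parent w (just p)
        new : parent′ w ≡ just p
        new = update-≡ parent w (just p)
        absurd : parent′ w ≢ nothing
        absurd eq with trans (sym new) eq
        ... | ()
        old : ∀ {x} → x ∈ xs → parent′ x ≡ parent x
        old x∈ = update-≢ parent (just p) (λ x≡w → w∉ (subst (_∈ xs) x≡w x∈))
        bu : ∀ ys → (∀ {y} → y ∈ ys → y ∈ xs) → AllPairs (λ u v → parent v ≢ just u) ys →
             AllPairs (λ u v → parent′ v ≢ just u) ys
        bu [] _ [] = []
        bu (y ∷ ys) sub (a ∷ as) =
          All.tabulate (λ z∈ eq → All.lookup a z∈ (trans (sym (old (sub (there z∈)))) eq)) ∷ bu ys (sub ∘ there) as
        -- A second neighbour of w among xs would close a cycle through w.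
        onlyNeighbour : ∀ {v} → v ∈ xs → Adj w v → v ≡ p
        onlyNeighbour {v} v∈ wv with v Fin.≟ p
        ... | yes v≡p = v≡p
        ... | no v≢p with path p∈ v∈
        ...   | ps , pth , uq , sub = ⊥-elim (acyclic w ps
                ( path-length (v≢p ∘ sym) pth
                , All.tabulate (λ x∈ w≡x → w∉ (subst (_∈ xs) (sym w≡x) (sub x∈))) ∷ uq
                , path-linked wp (path-snoc pth (symm wv))))
        link : ∀ {u v} → u ∈ w ∷ xs → v ∈ w ∷ xs → Adj u v → Link parent′ u v
        link (here refl) (here refl) uv = ⊥-elim (irrefl refl uv)
        link (here refl) (there v∈) uv = inj₁ (trans new (cong just (sym (onlyNeighbour v∈ uv))))
        link (there u∈) (here refl) uv = inj₂ (trans new (cong just (sym (onlyNeighbour u∈ (symm uv)))))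
        link (there u∈) (there v∈) uv with adj⇒link u∈ v∈ uv
        ... | inj₁ eq = inj₁ (trans (old u∈) eq)
        ... | inj₂ eq = inj₂ (trans (old v∈) eq)
        path′ : ∀ {u v} → u ∈ w ∷ xs → v ∈ w ∷ xs →
          ∃[ ps ] (Path u ps v × Unique ps × (∀ {x} → x ∈ ps → x ∈ w ∷ xs))
        path′ (here refl) (here refl) = [ w ] , [-] , ([] ∷ []) , λ { (here refl) → here refl }
        path′ (here refl) (there v∈) with path p∈ v∈
        ... | ps , pth , uq , sub = w ∷ ps , wp ∷ pth ,
          All.tabulate (λ x∈ w≡x → w∉ (subst (_∈ xs) (sym w≡x) (sub x∈))) ∷ uq ,
          λ { (here eq) → here eq ; (there x∈) → there (sub x∈) }
        path′ (there u∈) (here refl) with path u∈ p∈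
        ... | ps , pth , uq , sub = ps ++ [ w ] , path-snoc pth (symm wp) ,
          Unique.++⁺ uq ([] ∷ []) (λ { (x∈ , here refl) → w∉ (sub x∈) }) , sub′
          where
          sub′ : ∀ {x} → x ∈ ps ++ [ w ] → x ∈ w ∷ xs
          sub′ x∈ with ∈-++⁻ ps x∈
          ... | inj₁ x∈ps = there (sub x∈ps)
          ... | inj₂ (here eq) = here eq
        path′ (there u∈) (there v∈) with path u∈ v∈
        ... | ps , pth , uq , sub = ps , pth , uq , there ∘ sub

      -- While `k` vertices are missing, a walk from the root to one of them has an edge leaving
      -- `xs`, along which the subtree is extended.
      grow : ∀ k xs → length xs + k ≡ N → Subtree xs → ∃[ ys ] (Subtree ys × (∀ u → u ∈ ys))
      grow zero xs eq S = xs , S , all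
        where
        all : ∀ u → u ∈ xs
        all u with u ∈? xs
        ... | yes u∈ = u∈
        ... | no u∉ = ⊥-elim (<⇒≱ {N} {suc (length xs)} (s≤s (≤-reflexive (trans (sym eq) (+-identityʳ _))))
          (Unique⇒length≤ (All.tabulate (λ x∈ u≡x → u∉ (subst (_∈ xs) (sym u≡x) x∈)) ∷ Subtree.unique S)))
      grow (suc k) xs eq S
        with ∃-missing {xs = allFin N} {ys = xs} (Unique.allFin⁺ N)
               (subst₂ _<_ refl (trans eq (sym length-allFin)) (m<m+n (length xs) (s≤s z≤n)))
      ... | z , _ , z∉ with exit (Subtree.root∈ S) z∉ (connected (Subtree.root S) z)
      ...   | p , w , p∈ , w∉ , wp = grow k (w ∷ xs) (trans (sym (+-suc _ k)) eq) (attach S p∈ w∉ wp)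

      singleton : (r : Fin N) → Subtree [ r ]
      singleton r = record
        { root = r
        ; parent = const nothing
        ; root∈ = here refl
        ; unique = [] ∷ []
        ; bottomUp = [] ∷ []
        ; rootUnique = λ { (here eq) _ → eq }
        ; parent∈ = λ _ ()
        ; parent⇒adj = λ _ ()
        ; adj⇒link = λ { (here refl) (here refl) uv → ⊥-elim (irrefl refl uv) }
        ; path = λ { (here refl) (here refl) → [ r ] , [-] , ([] ∷ []) , id }
        }

  rooting : IsTree → Rooting
  rooting tree with vertex (IsTree.nonEmpty tree)
    where
    vertex : ∀ {m} → 0 < m → Fin m × ∃[ k ] (1 + k ≡ m)
    vertex {suc m} _ = zero , m , refl
  ... | r , k , eq with grow tree k [ r ] eq (singleton tree r)
  ...   | ys , S , all = record
    { root = root ; parent = parent ; order = ys ; covers = all ; unique = unique ; bottomUp = bottomUp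
    ; rootUnique = rootUnique (all _) ; parent⇒adj = parent⇒adj (all _)
    ; adj⇒link = adj⇒link (all _) (all _) }
    where open Subtree S

  ∈-neighborhood⁺ : ∀ {v w} → Adj v w → w Subset.∈ neighborhood v
  ∈-neighborhood⁺ {v} {w} vw =
    Vec.lookup⇒[]= w _ (trans (Vec.lookup∘tabulate _ w) (dec-true (adj? v w) vw))

  ∈-neighborhood⁻ : ∀ {v w} → w Subset.∈ neighborhood v → Adj v w
  ∈-neighborhood⁻ {v} {w} w∈ with adj? v w | trans (sym (Vec.lookup∘tabulate (does ∘ adj? v) w)) (Vec.[]=⇒lookup w∈)
  ... | yes vw | _ = vw
  ... | no _ | ()

  leaf-neighbour-unique : ∀ {v x y} → Leaf v → Adj v x → Adj v y → x ≡ y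
  leaf-neighbour-unique {v} leaf vx vy =
    two (trans (length-elements (neighborhood v)) leaf) (elem vx) (elem vy)
    where
    elem : ∀ {x} → Adj v x → x ∈ elements (neighborhood v)
    elem = ∈-elements⁺ ∘ ∈-neighborhood⁺
    two : ∀ {xs : List (Fin N)} {x y} → length xs ≡ 1 → x ∈ xs → y ∈ xs → x ≡ y
    two {_ ∷ []} _ (here refl) (here refl) = refl

-- The union of the embedded trees and its degrees.

∈-mapMaybe⁺ : (f : A → Maybe B) {x : A} {y : B} (xs : List A) → x ∈ xs → f x ≡ just y → y ∈ mapMaybe f xs
∈-mapMaybe⁺ f (x ∷ xs) (here refl) eq rewrite eq = here refl
∈-mapMaybe⁺ f (x ∷ xs) (there x∈) eq with f x
... | nothing = ∈-mapMaybe⁺ f xs x∈ eq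
... | just _ = there (∈-mapMaybe⁺ f xs x∈ eq)

∈-mapMaybe⁻ : (f : A → Maybe B) {y : B} (xs : List A) → y ∈ mapMaybe f xs → ∃[ x ] (x ∈ xs × f x ≡ just y)
∈-mapMaybe⁻ f (x ∷ xs) y∈ with f x in eq
... | nothing with ∈-mapMaybe⁻ f xs y∈
...   | z , z∈ , fz = z , there z∈ , fz
∈-mapMaybe⁻ f (x ∷ xs) (here refl) | just _ = x , here refl , eq
∈-mapMaybe⁻ f (x ∷ xs) (there y∈) | just _ with ∈-mapMaybe⁻ f xs y∈
...   | z , z∈ , fz = z , there z∈ , fz

-- The trees embedded so far are represented by their parent functions on the host vertices.
module Host {n : ℕ} (πs : List (Fin n → Maybe (Fin n))) where

  _≟ᴹ_ : DecidableEquality (Maybe (Fin n))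
  _≟ᴹ_ = ≡-dec Fin._≟_

  ups downs nbrs : Fin n → List (Fin n)
  ups v = mapMaybe (λ π → π v) πs
  downs v = concatMap (λ π → filter (λ u → π u ≟ᴹ just v) (allFin n)) πs
  nbrs v = ups v ++ downs v

  -- A host occurs here once for each of its children in the earlier trees. Counting occurrences
  -- thus counts children, and the total length counts the edges directed from child to parent.
  targets : List (Fin n)
  targets = concatMap (λ π → mapMaybe π (allFin n)) πs

  Used : Fin n → Fin n → Set
  Used a b = Any (λ π → Link π a b) πs

  Used-sym : ∀ {a b} → Used a b → Used b a
  Used-sym = Any.map λ { (inj₁ p) → inj₂ p ; (inj₂ p) → inj₁ p }

  Used⇒∈nbrs : ∀ {a b} → Used a b → b ∈ nbrs a
  Used⇒∈nbrs {a} {b} ab with find ab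
  ... | π , π∈ , inj₁ eq = ∈-++⁺ˡ (∈-mapMaybe⁺ (λ π → π a) πs π∈ eq)
  ... | π , π∈ , inj₂ eq = ∈-++⁺ʳ (ups a)
    (∈-concatMap⁺ (λ π → filter (λ u → π u ≟ᴹ just a) (allFin n))
      (lose π∈ (∈-filter⁺ (λ u → π u ≟ᴹ just a) (∈-allFin b) eq)))

  ∈downs⁻ : ∀ {a b} → b ∈ downs a → ∃[ π ] (π ∈ πs × π b ≡ just a)
  ∈downs⁻ {a} {b} b∈ with find (∈-concatMap⁻ (λ π → filter (λ u → π u ≟ᴹ just a) (allFin n)) {xs = πs} b∈)
  ... | π , π∈ , b∈f = π , π∈ , proj₂ (∈-filter⁻ (λ u → π u ≟ᴹ just a) {xs = allFin n} b∈f)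

  ∈nbrs⇒∈ups : ∀ {a b} → b ∈ nbrs a → b ∈ ups a ⊎ a ∈ ups b
  ∈nbrs⇒∈ups {a} {b} b∈ with ∈-++⁻ (ups a) b∈
  ... | inj₁ p = inj₁ p
  ... | inj₂ p with ∈downs⁻ p
  ...   | π , π∈ , eq = inj₂ (∈-mapMaybe⁺ (λ π → π b) πs π∈ eq)

  length-ups : ∀ v → length (ups v) ≤ length πs
  length-ups v = length-mapMaybe (λ π → π v) πs

  length-targets : length targets ≤ length πs * n
  length-targets = length-concatMap-≤ (λ π → mapMaybe π (allFin n)) πs
    (λ {π} _ → ≤-trans (length-mapMaybe π (allFin n)) (≤-reflexive length-allFin))

  length-downs : ∀ v → length (downs v) ≡ count v targets
  length-downs v = go πs
    where
    one : ∀ (π : Fin n → Maybe (Fin n)) us → length (filter (λ u → π u ≟ᴹ just v) us) ≡ count v (mapMaybe π us)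
    one π [] = refl
    one π (u ∷ us) with π u
    ... | nothing = one π us
    ... | just w with w Fin.≟ v | v Fin.≟ w
    ...   | yes _ | yes _ = cong suc (one π us)
    ...   | yes p | no q = ⊥-elim (q (sym p))
    ...   | no p | yes q = ⊥-elim (p (sym q))
    ...   | no _ | no _ = one π us
    go : ∀ ρs → length (concatMap (λ π → filter (λ u → π u ≟ᴹ just v) (allFin n)) ρs)
              ≡ count v (concatMap (λ π → mapMaybe π (allFin n)) ρs)
    go [] = refl
    go (π ∷ ρs) = trans (length-++ (filter (λ u → π u ≟ᴹ just v) (allFin n)))
      (trans (cong₂ _+_ (one π (allFin n)) (go ρs)) (sym (count-++ v (mapMaybe π (allFin n)) _)))

  -- Each earlier tree contributes at most one parent. A host can therefore have large degree only
  -- through its children, and hosts with many children are rare by `targets-markov`.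
  length-nbrs : ∀ v → length (nbrs v) ≤ length πs + count v targets
  length-nbrs v = ≤-trans (≤-reflexive (length-++ (ups v)))
    (+-mono-≤ (length-ups v) (≤-reflexive (length-downs v)))

  targets-markov : ∀ m {vs} → Unique vs → (∀ {v} → v ∈ vs → m ≤ count v targets) → length vs * m ≤ length πs * n
  targets-markov m u m≤ = ≤-trans (markov m targets u m≤) length-targets

-- Greedy extension of a partial embedding.

∈-concatMap : (f : A → List B) {x : A} {y : B} {xs : List A} → x ∈ xs → y ∈ f x → y ∈ concatMap f xs
∈-concatMap f x∈ y∈ = ∈-concatMap⁺ f (lose x∈ y∈)

module Embed {n N : ℕ} (πs : List (Fin n → Maybe (Fin n)))
  (parent : Fin N → Maybe (Fin N)) (parent-irrefl : ∀ {u} → parent u ≢ just u) where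

  open Host πs

  -- A partial embedding is encoded as a total function with arbitrary values outside `dom`.
  record Good (f : Fin N → Fin n) (dom : List (Fin N)) : Set where
    field
      inj  : ∀ {u w} → u ∈ dom → w ∈ dom → f u ≡ f w → u ≡ w
      edge : ∀ {u w} → u ∈ dom → w ∈ dom → parent u ≡ just w → ¬ Used (f u) (f w)
  open Good

  children : Fin N → List (Fin N) → List (Fin N)
  children u = filter (λ w → ≡-dec Fin._≟_ (parent w) (just u))

  place : ∀ {f dom} u h → Good f dom → u ∉ dom → h ∉ map f dom →
    (∀ {w} → w ∈ dom → parent u ≡ just w → ¬ Used (f w) h) →
    (∀ {w} → w ∈ dom → parent w ≡ just u → ¬ Used (f w) h) →
    Good (update f u h) (u ∷ dom)
  place {f} {dom} u h g u∉ h∉ up down = record { inj = inj′ ; edge = edge′ }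
    where
    f′ = update f u h
    old : ∀ {w} → w ∈ dom → f′ w ≡ f w
    old w∈ = update-≢ f h (λ w≡u → u∉ (subst (_∈ dom) w≡u w∈))
    fresh : ∀ {w} → w ∈ dom → f′ u ≢ f′ w
    fresh w∈ eq = h∉ (subst (_∈ map f dom)
      (trans (sym (old w∈)) (trans (sym eq) (update-≡ f u h))) (∈-map⁺ f w∈))
    inj′ : ∀ {a b} → a ∈ u ∷ dom → b ∈ u ∷ dom → f′ a ≡ f′ b → a ≡ b
    inj′ (here refl) (here refl) _ = refl
    inj′ (here refl) (there b∈) eq = ⊥-elim (fresh b∈ eq)
    inj′ (there a∈) (here refl) eq = ⊥-elim (fresh a∈ (sym eq))
    inj′ (there a∈) (there b∈) eq = inj g a∈ b∈ (trans (sym (old a∈)) (trans eq (old b∈)))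
    edge′ : ∀ {a b} → a ∈ u ∷ dom → b ∈ u ∷ dom → parent a ≡ just b → ¬ Used (f′ a) (f′ b)
    edge′ (here refl) (here refl) eq = ⊥-elim (parent-irrefl eq)
    edge′ (here refl) (there b∈) eq rewrite old b∈ | update-≡ f u h = up b∈ eq ∘ Used-sym
    edge′ (there a∈) (here refl) eq rewrite old a∈ | update-≡ f u h = down a∈ eq
    edge′ (there a∈) (there b∈) eq rewrite old a∈ | old b∈ = edge g a∈ b∈ eq

  private
    parentNbrs : (Fin N → Fin n) → List (Fin N) → Maybe (Fin N) → List (Fin n)
    parentNbrs f dom nothing = []
    parentNbrs f dom (just w) with w ∈? dom
    ... | yes _ = nbrs (f w)
    ... | no _ = []

    ∈-parentNbrs : ∀ f {dom w h} → w ∈ dom → h ∈ nbrs (f w) → h ∈ parentNbrs f dom (just w)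
    ∈-parentNbrs f {dom} {w} w∈ h∈ with w ∈? dom
    ... | yes _ = h∈
    ... | no w∉ = ⊥-elim (w∉ w∈)

    length-parentNbrs : ∀ f {dom δ} m → (∀ {w} → w ∈ dom → m ≡ just w → length (nbrs (f w)) ≤ δ) →
      length (parentNbrs f dom m) ≤ δ
    length-parentNbrs f nothing _ = z≤n
    length-parentNbrs f {dom} (just w) δ≤ with w ∈? dom
    ... | yes w∈ = δ≤ w∈ refl
    ... | no _ = z≤n

  -- A host is forbidden if it is occupied, if it is adjacent to the host of the parent of `u` (at
  -- most `δ` of these), or if it is adjacent to the host of one of the at most `k` placed children
  -- (at most `κ` for each child). The last hypothesis leaves an allowed host outside all of these.
  place∃ : ∀ {f dom δ κ k allowed} u → Good f dom → u ∉ dom → Unique allowed →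
    (∀ {w} → w ∈ dom → parent u ≡ just w → length (nbrs (f w)) ≤ δ) →
    (∀ {w} → w ∈ children u dom → length (nbrs (f w)) ≤ κ) →
    length (children u dom) ≤ k →
    length dom + (δ + k * κ) < length allowed →
    ∃[ h ] (h ∈ allowed × Good (update f u h) (u ∷ dom))
  place∃ {f} {dom} {δ} {κ} {k} {allowed} u g u∉ uq δ≤ κ≤ k≤ lt = finish (∃-missing uq (≤-<-trans len lt))
    where
    near = parentNbrs f dom (parent u)
    forbidden = map f dom ++ (near ++ concatMap (nbrs ∘ f) (children u dom))
    len : length forbidden ≤ length dom + (δ + k * κ)
    len = ≤-trans (≤-reflexive (trans (length-++ (map f dom)) (cong₂ _+_ (length-map f dom) (length-++ near))))
      (+-monoʳ-≤ (length dom) (+-mono-≤ (length-parentNbrs f (parent u) δ≤)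
        (≤-trans (length-concatMap-≤ (nbrs ∘ f) (children u dom) κ≤) (*-monoˡ-≤ κ k≤))))
    finish : ∃[ h ] (h ∈ allowed × h ∉ forbidden) → ∃[ h ] (h ∈ allowed × Good (update f u h) (u ∷ dom))
    finish (h , h∈ , h∉) = h , h∈ , place u h g u∉ (h∉ ∘ ∈-++⁺ˡ)
      (λ w∈ eq used → h∉ (∈-++⁺ʳ (map f dom) (∈-++⁺ˡ
        (subst (λ m → h ∈ parentNbrs f dom m) (sym eq) (∈-parentNbrs f w∈ (Used⇒∈nbrs used))))))
      (λ {w} w∈ eq used → h∉ (∈-++⁺ʳ (map f dom) (∈-++⁺ʳ near
        (∈-concatMap (nbrs ∘ f) (∈-filter⁺ (λ w → ≡-dec Fin._≟_ (parent w) (just u)) w∈ eq) (Used⇒∈nbrs used)))))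

  -- The list us is placed from its end, each vertex before its children in us.
  placeAll : ∀ {δ κ k} (allowed : Fin N → List (Fin n)) → (∀ u → Unique (allowed u)) →
    ∀ {f dom} us → Good f dom → Unique us → AllPairs (λ u v → parent v ≢ just u) us →
    (∀ {u} → u ∈ us → u ∉ dom) →
    (∀ {w} → w ∈ dom → length (nbrs (f w)) ≤ δ) →
    (∀ {w} → w ∈ dom → ∀ {u} → u ∈ us → parent w ≡ just u → length (nbrs (f w)) ≤ κ) →
    (∀ {u} → u ∈ us → length (children u dom) ≤ k) →
    (∀ {u} → u ∈ us → ∀ {h} → h ∈ allowed u → length (nbrs h) ≤ δ) →
    (∀ {u} → u ∈ us → length us + length dom + (δ + k * κ) ≤ length (allowed u)) →
    ∃[ f′ ] (Good f′ (us ++ dom) × (∀ {x} → x ∈ dom → f′ x ≡ f x) × (∀ {u} → u ∈ us → f′ u ∈ allowed u))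
  placeAll allowed uqA {f} [] g _ _ _ _ _ _ _ _ = f , g , (λ _ → refl) , λ ()
  placeAll {δ} {κ} {k} allowed uqA {f} {dom} (u ∷ us) g (u# ∷ uq) (b ∷ bs) ∉dom δ≤ κ≤ k≤ aδ≤ len
    with placeAll {δ} {κ} {k} allowed uqA us g uq bs (∉dom ∘ there) δ≤ (λ w∈ u∈ → κ≤ w∈ (there u∈))
           (k≤ ∘ there) (aδ≤ ∘ there) (λ u∈ → ≤-trans (n≤1+n _) (len (there u∈)))
  ... | f′ , g′ , keep , ok = extend (place∃ {k = k} u g′ u∉ (uqA u) near≤ kids≤ kidsLen
          (≤-trans (≤-reflexive (cong (λ m → suc (m + (δ + k * κ))) (length-++ us))) (len (here refl))))
    where
    u∉us : u ∉ us
    u∉us u∈ = All.lookup u# u∈ refl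
    u∉ : u ∉ us ++ dom
    u∉ u∈ with ∈-++⁻ us u∈
    ... | inj₁ u∈us = u∉us u∈us
    ... | inj₂ u∈dom = ∉dom (here refl) u∈dom
    near≤ : ∀ {w} → w ∈ us ++ dom → parent u ≡ just w → length (nbrs (f′ w)) ≤ δ
    near≤ w∈ _ with ∈-++⁻ us w∈
    ... | inj₁ w∈us = aδ≤ (there w∈us) (ok w∈us)
    ... | inj₂ w∈dom rewrite keep w∈dom = δ≤ w∈dom
    -- The order is bottom-up, so none of the vertices of the list placed before `u` is a child of
    -- `u`; its placed children all lie in `dom`.
    childrenEq : children u (us ++ dom) ≡ children u dom
    childrenEq = trans (filter-++ (λ w → ≡-dec Fin._≟_ (parent w) (just u)) us dom)
      (cong (_++ children u dom) (filter-none (λ w → ≡-dec Fin._≟_ (parent w) (just u)) b))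
    kids≤ : ∀ {w} → w ∈ children u (us ++ dom) → length (nbrs (f′ w)) ≤ κ
    kids≤ w∈ with ∈-filter⁻ (λ w → ≡-dec Fin._≟_ (parent w) (just u)) {xs = dom} (subst (_ ∈_) childrenEq w∈)
    ... | w∈dom , eq rewrite keep w∈dom = κ≤ w∈dom (here refl) eq
    kidsLen : length (children u (us ++ dom)) ≤ k
    kidsLen = ≤-trans (≤-reflexive (cong length childrenEq)) (k≤ (here refl))
    extend : ∃[ h ] (h ∈ allowed u × Good (update f′ u h) (u ∷ us ++ dom)) →
      ∃[ f″ ] (Good f″ (u ∷ us ++ dom) × (∀ {x} → x ∈ dom → f″ x ≡ f x) × (∀ {v} → v ∈ u ∷ us → f″ v ∈ allowed v))
    extend (h , h∈ , g″) = update f′ u h , g″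
      , (λ x∈ → trans (update-≢ f′ h (λ x≡u → ∉dom (here refl) (subst (_∈ dom) x≡u x∈))) (keep x∈))
      , λ { (here refl) → subst (_∈ allowed u) (sym (update-≡ f′ u h)) h∈
          ; {v} (there v∈) → subst (_∈ allowed v)
              (sym (update-≢ f′ h (λ v≡u → u∉us (subst (_∈ us) v≡u v∈)))) (ok v∈) }

-- Placing the withheld leaves, with exchanges.

assign : ∀ {N n} (f : Fin N → Fin n) Ls Z → Unique Ls → Unique Z → length Ls ≤ length Z →
  ∃ λ (f′ : Fin N → Fin n) → ((∀ {x} → x ∉ Ls → f′ x ≡ f x) × (∀ {l} → l ∈ Ls → f′ l ∈ Z) ×
           (∀ {k l} → k ∈ Ls → l ∈ Ls → f′ k ≡ f′ l → k ≡ l))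
assign f [] Z _ _ _ = f , (λ _ → refl) , (λ ()) , λ ()
assign f (l ∷ Ls) (z ∷ Z) (l# ∷ uL) (z# ∷ uZ) (s≤s len) with assign f Ls Z uL uZ len
... | f′ , keep , into , inj = f″ , keep″ , into″ , inj″
  where
  f″ = update f′ l z
  old : ∀ {x} → x ∈ Ls → f″ x ≡ f′ x
  old x∈ = update-≢ f′ z (λ x≡l → All.lookup l# x∈ (sym x≡l))
  keep″ : ∀ {x} → x ∉ l ∷ Ls → f″ x ≡ f x
  keep″ x∉ = trans (update-≢ f′ z (x∉ ∘ here)) (keep (x∉ ∘ there))
  into″ : ∀ {x} → x ∈ l ∷ Ls → f″ x ∈ z ∷ Z
  into″ (here refl) = here (update-≡ f′ l z)
  into″ (there x∈) = there (subst (_∈ Z) (sym (old x∈)) (into x∈))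
  fresh : ∀ {x} → x ∈ Ls → f″ l ≢ f″ x
  fresh x∈ eq = All.lookup z# (into x∈) (trans (sym (update-≡ f′ l z)) (trans eq (old x∈)))
  inj″ : ∀ {j k} → j ∈ l ∷ Ls → k ∈ l ∷ Ls → f″ j ≡ f″ k → j ≡ k
  inj″ (here refl) (here refl) _ = refl
  inj″ (here refl) (there k∈) eq = ⊥-elim (fresh k∈ eq)
  inj″ (there j∈) (here refl) eq = ⊥-elim (fresh j∈ (sym eq))
  inj″ (there j∈) (there k∈) eq = inj j∈ k∈ (trans (sym (old j∈)) (trans eq (old k∈)))

transpose-ˡ : ∀ {n} (i j : Fin n) → transpose i j i ≡ j
transpose-ˡ i j with i Fin.≟ i
... | yes _ = refl
... | no i≢i = ⊥-elim (i≢i refl)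

transpose-ʳ : ∀ {n} (i j : Fin n) → transpose i j j ≡ i
transpose-ʳ i j with j Fin.≟ i
... | yes j≡i = j≡i
... | no _ with j Fin.≟ j
...   | yes _ = refl
...   | no j≢j = ⊥-elim (j≢j refl)

transpose-≢ : ∀ {n} (i j : Fin n) {k} → k ≢ i → k ≢ j → transpose i j k ≡ k
transpose-≢ i j {k} k≢i k≢j with k Fin.≟ i
... | yes k≡i = ⊥-elim (k≢i k≡i)
... | no _ with k Fin.≟ j
...   | yes k≡j = ⊥-elim (k≢j k≡j)
...   | no _ = refl

transpose-injective : ∀ {n} (i j : Fin n) {k l} → transpose i j k ≡ transpose i j l → k ≡ l
transpose-injective i j eq = trans (sym (transpose-inverse j i)) (trans (cong (transpose j i) eq) (transpose-inverse j i))

module Finish {n N : ℕ} (πs : List (Fin n → Maybe (Fin n)))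
  (parent : Fin N → Maybe (Fin N)) (parent-irrefl : ∀ {u} → parent u ≢ just u) where

  open Host πs
  open Embed πs parent parent-irrefl
  open Good

  record Extension (f : Fin N → Fin n) (dom : List (Fin N)) : Set where
    field
      to        : Fin N → Fin n
      injective : ∀ {u w} → to u ≡ to w → u ≡ w
      edges     : ∀ {u w} → parent u ≡ just w → ¬ Used (to u) (to w)
      keeps     : ∀ {x} → x ∈ dom → to x ≡ f x

  -- Start from any injection of the remaining leaves into Z.  A leaf l at a forbidden host v
  -- is exchanged with some l′ ∈ L₀ such that v suits l′ and the host of l′ suits l: more than m
  -- leaves of L₀ suit v, and at most m hosts are forbidden for l.
  finish : ∀ {f dom m} Ls Z (pa : Fin N → Fin N) L₀ → Good f dom → Unique Ls → Unique Z → Unique L₀ →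
    (∀ u → u ∈ dom ⊎ u ∈ Ls) → (∀ {z} → z ∈ Z → z ∉ map f dom) → length Ls ≤ length Z →
    (∀ {l} → l ∈ Ls → l ∉ dom × parent l ≡ just (pa l) × pa l ∈ dom × length (nbrs (f (pa l))) ≤ m) →
    (∀ {u l} → l ∈ Ls → parent u ≢ just l) →
    (∀ {l} → l ∈ L₀ → l ∈ Ls) →
    (∀ {z} → z ∈ Z → m < length (filter (λ l → z ∉? nbrs (f (pa l))) L₀)) →
    Extension f dom
  finish {f} {dom} {m} Ls Z pa L₀ g uL uZ u₀ cover Z∉ len leaf childless sub many = result (repair Ls id)
    where
    record Placed (f′ : Fin N → Fin n) : Set where
      field
        injective : ∀ {u w} → f′ u ≡ f′ w → u ≡ w
        keeps     : ∀ {x} → x ∈ dom → f′ x ≡ f x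
        into      : ∀ {l} → l ∈ Ls → f′ l ∈ Z
    open Placed

    Suits : (Fin N → Fin n) → Fin N → Set
    Suits f′ l = f′ l ∉ nbrs (f (pa l))

    start : ∃[ f′ ] Placed f′
    start with assign f Ls Z uL uZ len
    ... | f′ , keep , in′ , inj′ = f′ , record { injective = λ {u} {w} → injf′ (cover u) (cover w) ; keeps = keep′ ; into = in′ }
      where
      keep′ : ∀ {x} → x ∈ dom → f′ x ≡ f x
      keep′ x∈ = keep (λ x∈L → proj₁ (leaf x∈L) x∈)
      clash : ∀ {u w} → u ∈ dom → w ∈ Ls → f′ u ≢ f′ w
      clash u∈ w∈ eq = Z∉ (in′ w∈) (subst (_∈ map f dom) (trans (sym (keep′ u∈)) eq) (∈-map⁺ f u∈))
      injf′ : ∀ {u w} → u ∈ dom ⊎ u ∈ Ls → w ∈ dom ⊎ w ∈ Ls → f′ u ≡ f′ w → u ≡ w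
      injf′ (inj₁ u∈) (inj₁ w∈) eq = inj g u∈ w∈ (trans (sym (keep′ u∈)) (trans eq (keep′ w∈)))
      injf′ (inj₁ u∈) (inj₂ w∈) eq = ⊥-elim (clash u∈ w∈ eq)
      injf′ (inj₂ u∈) (inj₁ w∈) eq = ⊥-elim (clash w∈ u∈ (sym eq))
      injf′ (inj₂ u∈) (inj₂ w∈) eq = inj′ u∈ w∈ eq

    repair : ∀ ls → (∀ {l} → l ∈ ls → l ∈ Ls) → ∃[ f′ ] (Placed f′ × (∀ {l} → l ∈ ls → Suits f′ l))
    repair [] _ with start
    ... | f′ , p = f′ , p , λ ()
    repair (l ∷ ls) sub′ with repair ls (sub′ ∘ there)
    ... | f′ , p , ok with f′ l ∈? nbrs (f (pa l))
    ...   | no suits = f′ , p , λ { (here refl) → suits ; (there k∈) → ok k∈ }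
    ...   | yes bad = swap (∃-missing {xs = map f′ cands} (Unique.map⁺ (injective p) (Unique.filter⁺ _ u₀))
              (≤-<-trans (proj₂ (proj₂ (proj₂ (leaf l∈)))) (subst (m <_) (sym (length-map f′ cands)) (many (into p l∈)))))
      where
      l∈ = sub′ (here refl)
      cands = filter (λ k → f′ l ∉? nbrs (f (pa k))) L₀
      swap : ∃[ v ] (v ∈ map f′ cands × v ∉ nbrs (f (pa l))) →
        ∃[ f″ ] (Placed f″ × (∀ {k} → k ∈ l ∷ ls → Suits f″ k))
      swap (v , v∈ , v∉) with ∈-map⁻ f′ v∈
      ... | k , k∈ , refl with ∈-filter⁻ (λ k → f′ l ∉? nbrs (f (pa k))) {xs = L₀} k∈
      -- The exchange repairs `l`, gives `k` a host that suits it, and moves no other leaf, so that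
      -- the leaves treated earlier remain correct even if `k` is one of them.
      ...   | k∈L₀ , suitsk = f′ ∘ transpose l k , placed , suit
        where
        k∈Ls = sub k∈L₀
        placed : Placed (f′ ∘ transpose l k)
        placed = record
          { injective = transpose-injective l k ∘ injective p
          ; keeps = λ x∈ → trans (cong f′ (transpose-≢ l k
              (λ x≡l → proj₁ (leaf l∈) (subst (_∈ dom) x≡l x∈))
              (λ x≡k → proj₁ (leaf k∈Ls) (subst (_∈ dom) x≡k x∈)))) (keeps p x∈)
          ; into = into′ }
          where
          into′ : ∀ {j} → j ∈ Ls → f′ (transpose l k j) ∈ Z
          into′ {j} j∈ with j Fin.≟ l
          ... | yes _ = into p k∈Ls
          ... | no _ with j Fin.≟ k
          ...   | yes _ = into p l∈
          ...   | no _ = into p j∈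
        suit : ∀ {j} → j ∈ l ∷ ls → Suits (f′ ∘ transpose l k) j
        suit {j} j∈ = suit′ j∈ (j Fin.≟ l) (j Fin.≟ k)
          where
          suit′ : ∀ {j} → j ∈ l ∷ ls → Dec (j ≡ l) → Dec (j ≡ k) → Suits (f′ ∘ transpose l k) j
          suit′ _ (yes refl) _ = subst (λ x → f′ x ∉ nbrs (f (pa l))) (sym (transpose-ˡ l k)) v∉
          suit′ _ (no _) (yes refl) = subst (λ x → f′ x ∉ nbrs (f (pa k))) (sym (transpose-ʳ l k)) suitsk
          suit′ (here refl) (no l≢l) (no _) = ⊥-elim (l≢l refl)
          suit′ {j} (there j∈) (no j≢l) (no j≢k) =
            subst (λ x → f′ x ∉ nbrs (f (pa j))) (sym (transpose-≢ l k j≢l j≢k)) (ok j∈)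

    result : ∃[ f′ ] (Placed f′ × (∀ {l} → l ∈ Ls → Suits f′ l)) → Extension f dom
    result (f′ , p , ok) = record { to = f′ ; injective = injective p ; edges = edges ; keeps = keeps p }
      where
      edges : ∀ {u w} → parent u ≡ just w → ¬ Used (f′ u) (f′ w)
      edges {u} {w} eq used with cover u | cover w
      ... | _ | inj₂ w∈ = childless w∈ eq
      ... | inj₁ u∈ | inj₁ w∈ rewrite keeps p u∈ | keeps p w∈ = edge g u∈ w∈ eq used
      ... | inj₂ u∈ | inj₁ w∈ with leaf u∈
      ...   | _ , eq′ , _ , _ with just-injective (trans (sym eq) eq′)
      ...     | refl = ok u∈ (Used⇒∈nbrs (Used-sym (subst (λ h → Used (f′ u) h) (keeps p w∈) used)))

-- Closing a set under vertices with two children in it.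

module _ {N : ℕ} (parent : Fin N → Maybe (Fin N)) where

  childCount : Fin N → List (Fin N) → ℕ
  childCount u xs = count u (mapMaybe parent xs)

  childCount-∷ : ∀ u x xs → childCount u xs ≤ childCount u (x ∷ xs)
  childCount-∷ u x xs with parent x
  ... | nothing = ≤-refl
  ... | just y with u Fin.≟ y
  ...   | yes _ = n≤1+n _
  ...   | no _ = ≤-refl

  record Closure (P : List (Fin N)) : Set where
    field
      carrier  : List (Fin N)
      unique   : Unique carrier
      contains : ∀ {x} → x ∈ P → x ∈ carrier
      forced   : ∀ {x} → x ∈ carrier → x ∈ P ⊎ 2 ≤ childCount x carrier
      closed   : ∀ {x} → x ∉ carrier → childCount x carrier ≤ 1

    -- Vertices outside `P` are branching, that is, they have two children in the carrier. Each
    -- carrier vertex has at most one parent, so at most half as many vertices as the carrier has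
    -- are branching; the rest of the count is bounded by `P`.
    length-carrier : length carrier ≤ 2 * length P
    length-carrier = +-cancelʳ-≤ (length carrier) (length carrier) (2 * length P) (begin
      length carrier + length carrier      ≤⟨ +-mono-≤ split split ⟩
      (p + length branching) + (p + length branching) ≡⟨ solve p (length branching) ⟩
      2 * p + length branching * 2         ≤⟨ +-monoʳ-≤ (2 * p) half ⟩
      2 * p + length carrier               ∎)
      where
      open ≤-Reasoning
      p = length P
      branching = filter (λ x → 2 ≤? childCount x carrier) carrier
      solve : ∀ a b → (a + b) + (a + b) ≡ 2 * a + b * 2
      solve = solve-∀
      split : length carrier ≤ p + length branching
      split = ≤-trans (⊆-length unique cover) (≤-reflexive (length-++ P))
        where
        cover : ∀ {x} → x ∈ carrier → x ∈ P ++ branching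
        cover x∈ with forced x∈
        ... | inj₁ x∈P = ∈-++⁺ˡ x∈P
        ... | inj₂ two = ∈-++⁺ʳ P (∈-filter⁺ (λ x → 2 ≤? childCount x carrier) x∈ two)
      half : length branching * 2 ≤ length carrier
      half = ≤-trans (markov 2 (mapMaybe parent carrier) (Unique.filter⁺ (λ x → 2 ≤? childCount x carrier) unique)
          (λ x∈ → proj₂ (∈-filter⁻ (λ x → 2 ≤? childCount x carrier) {xs = carrier} x∈)))
        (length-mapMaybe parent carrier)

  abstract
    -- Vertices with two children in the set are added one by one. Child counts only increase, so
    -- the vertices added earlier remain justified. The argument `k` of `go` bounds the number of
    -- vertices outside `E`; at zero no further vertex can exist.
    closure : ∀ {P} → Unique P → Closure P
    closure {P} uP = go N P uP (m≤n+m N (length P)) id inj₁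
      where
      go : ∀ k E → Unique E → N ≤ length E + k → (∀ {x} → x ∈ P → x ∈ E) →
        (∀ {x} → x ∈ E → x ∈ P ⊎ 2 ≤ childCount x E) → Closure P
      go k E uE le sub frc with any? (λ x → (x ∉? E) ×-dec (2 ≤? childCount x E)) (allFin N)
      ... | no ∄ = record { carrier = E ; unique = uE ; contains = sub ; forced = frc
                          ; closed = λ {x} x∉ → ≤-pred (≰⇒> (λ two → ∄ (lose (∈-allFin x) (x∉ , two)))) }
      ... | yes found with find found
      ...   | x , _ , x∉ , two with All.tabulate (λ y∈ x≡y → x∉ (subst (_∈ E) (sym x≡y) y∈)) ∷ uE
      ...     | uxE = next k le
        where
        next : ∀ k → N ≤ length E + k → Closure P
        next zero le = ⊥-elim (<⇒≱ (Unique⇒length≤ uxE) (subst (N ≤_) (+-identityʳ _) le))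
        next (suc k) le = go k (x ∷ E) uxE (subst (N ≤_) (+-suc (length E) k) le) (there ∘ sub)
          λ { (here refl) → inj₂ (≤-trans two (childCount-∷ x x E))
            ; {y} (there y∈) → frc′ y∈ (frc y∈) }
          where
          frc′ : ∀ {y} → y ∈ E → y ∈ P ⊎ 2 ≤ childCount y E → y ∈ P ⊎ 2 ≤ childCount y (x ∷ E)
          frc′ _ (inj₁ p) = inj₁ p
          frc′ {y} _ (inj₂ p) = inj₂ (≤-trans p (childCount-∷ y x E))

-- The numerical content of the choice of t.  The field r is the number of leaves that both
-- hypotheses on a tree guarantee, and greedy is the inequality that fixes the constant 1/4.
record Sizes (n s r : ℕ) : Set where
  t = suc s
  field
    s-pos     : 20 ≤ s
    n-lower   : 64 * (t * (t * t)) ≤ n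
    r-lower   : 16 * (t * t) ≤ r
    r-upper   : r ≤ 18 * (t * t)
    manyLeaves : ∀ {x} → n ^ 2 ≤ x ^ 3 → r ≤ x
    fewParents : ∀ {x} → x ^ 3 ≤ n → x * (4 * s) + 2 ≤ r × x ≤ 4 * t + 4
    greedy    : ∀ {h j} → j ≤ s → h * suc (8 * (t * t)) ≤ j * n → h + 8 * (t * t) + 5 * t + j + 1 ≤ r

-- Classes of hosts, and the division of a tree into core, rest and leaves.

allPairs-++⁻ : {R : A → A → Set} (xs : List A) {ys : List A} → AllPairs R (xs ++ ys) →
  AllPairs R xs × AllPairs R ys × (∀ {x y} → x ∈ xs → y ∈ ys → R x y)
allPairs-++⁻ [] p = [] , p , λ ()
allPairs-++⁻ (x ∷ xs) (a ∷ p) with allPairs-++⁻ xs p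
... | l , r , c = All.tabulate (λ y∈ → All.lookup a (∈-++⁺ˡ y∈)) ∷ l , r ,
  λ { (here refl) y∈ → All.lookup a (∈-++⁺ʳ xs y∈) ; (there x∈) y∈ → c x∈ y∈ }

length-below : ∀ {n} t → length (filter (λ (h : Fin n) → toℕ h <? t) (allFin n)) ≤ t
length-below {n} t = subst₂ _≤_ (length-map toℕ below) (length-upTo t)
  (⊆-length (Unique.map⁺ Fin.toℕ-injective (Unique.filter⁺ (λ h → toℕ h <? t) (Unique.allFin⁺ n))) sub)
  where
  below = filter (λ (h : Fin n) → toℕ h <? t) (allFin n)
  sub : ∀ {x} → x ∈ map toℕ below → x ∈ upTo t
  sub x∈ with ∈-map⁻ toℕ x∈
  ... | h , h∈ , refl = ∈-upTo⁺ (proj₂ (∈-filter⁻ (λ h → toℕ h <? t) {xs = allFin n} h∈))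

count-∈ : ∀ {k} {v : Fin k} xs → 1 ≤ count v xs → v ∈ xs
count-∈ {v = v} (x ∷ xs) le with v Fin.≟ x
... | yes v≡x = here v≡x
... | no _ = there (count-∈ xs le)

module Step {n N s r : ℕ} (sizes : Sizes n s r) (πs : List (Fin n → Maybe (Fin n)))
  (j≤s : length πs ≤ s) (N+j≡n : N + length πs ≡ n)
  {G : Graph N} (R : Rooting G) where

  open Sizes sizes public
  open Rooting R public
  open Host πs public

  j = length πs

  parent-irrefl : ∀ {u} → parent u ≢ just u
  parent-irrefl eq = Graph.irrefl G refl (parent⇒adj eq)

  open Embed πs parent parent-irrefl public
  open Finish πs parent parent-irrefl public

  Low? : Decidable (λ h → t ≤ toℕ h × length (nbrs h) ≤ 4 * s)
  Low? h = (t ≤? toℕ h) ×-dec (length (nbrs h) ≤? 4 * s)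

  -- The core goes to `low` hosts; `heavy` hosts are the ones too crowded for the rest. The indices
  -- below `t` are reserved because host k is meant for the vertex carrying many leaves in tree k,
  -- counted from 0, if that tree has one.
  low busy heavy reserved : List (Fin n)
  low = filter Low? (allFin n)
  busy = filter (λ h → 4 * s <? length (nbrs h)) (allFin n)
  heavy = filter (λ h → 8 * (t * t) <? count h targets) (allFin n)
  reserved = filter (λ h → toℕ h <? t) (allFin n)

  low-unique : Unique low
  low-unique = Unique.filter⁺ Low? (Unique.allFin⁺ n)

  ∈low⁻ : ∀ {h} → h ∈ low → t ≤ toℕ h × length (nbrs h) ≤ 4 * s
  ∈low⁻ h∈ = proj₂ (∈-filter⁻ Low? {xs = allFin n} h∈)

  -- A busy host has more than 4s neighbours, of which at most s are parents, hence at least 3s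
  -- children. There are at most sn edges, so at most a third of the hosts are busy.
  length-busy : length busy * 3 ≤ n
  length-busy = *-cancelʳ-≤ (length busy * 3) n s {{>-nonZero (≤-trans (s≤s z≤n) s-pos)}} (begin
    length busy * 3 * s     ≡⟨ *-assoc (length busy) 3 s ⟩
    length busy * (3 * s)   ≤⟨ targets-markov (3 * s) (Unique.filter⁺ _ (Unique.allFin⁺ n)) many ⟩
    j * n                   ≤⟨ *-monoˡ-≤ n j≤s ⟩
    s * n                   ≡⟨ *-comm s n ⟩
    n * s                   ∎)
    where
    open ≤-Reasoning
    many : ∀ {h} → h ∈ busy → 3 * s ≤ count h targets
    many {h} h∈ = +-cancelˡ-≤ s (3 * s) _ (begin
      4 * s                    ≤⟨ <⇒≤ (proj₂ (∈-filter⁻ (λ h → 4 * s <? length (nbrs h)) {xs = allFin n} h∈)) ⟩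
      length (nbrs h)          ≤⟨ length-nbrs h ⟩
      j + count h targets      ≤⟨ +-monoˡ-≤ _ j≤s ⟩
      s + count h targets      ∎)

  length-low : n ≤ length low + (t + length busy)
  length-low = ≤-trans (cover-length low (reserved ++ busy) cover)
    (+-monoʳ-≤ (length low) (≤-trans (≤-reflexive (length-++ reserved)) (+-monoˡ-≤ _ (length-below {n} t))))
    where
    cover : ∀ h → h ∈ low ⊎ h ∈ reserved ++ busy
    cover h with t ≤? toℕ h | length (nbrs h) ≤? 4 * s
    ... | yes p | yes q = inj₁ (∈-filter⁺ Low? (∈-allFin h) (p , q))
    ... | no p | _ = inj₂ (∈-++⁺ˡ (∈-filter⁺ (λ h → toℕ h <? t) (∈-allFin h) (≰⇒> p)))
    ... | yes _ | no q = inj₂ (∈-++⁺ʳ reserved (∈-filter⁺ (λ h → 4 * s <? length (nbrs h)) (∈-allFin h) (≰⇒> q)))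

  heavy-greedy : length heavy + 8 * (t * t) + 5 * t + j + 1 ≤ r
  heavy-greedy = greedy j≤s (targets-markov _ (Unique.filter⁺ _ (Unique.allFin⁺ n))
    (λ h∈ → proj₂ (∈-filter⁻ (λ h → 8 * (t * t) <? count h targets) {xs = allFin n} h∈)))

  -- `L` consists of the withheld leaves and `P` contains their parents. The successor in the last
  -- bound allows for one leaf lost when the root is itself a leaf.
  module Leaves (L P : List (Fin N)) (pa : Fin N → Fin N) (uL : Unique L) (uP : Unique P)
    (parent-L : ∀ {l} → l ∈ L → parent l ≡ just (pa l)) (childless : ∀ {u l} → l ∈ L → parent u ≢ just l)
    (P∌L : ∀ {x} → x ∈ P → x ∉ L) (pa∈P : ∀ {l} → l ∈ L → pa l ∈ P) (r≤ : r ≤ suc (length L)) where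

    module E = Closure (closure parent uP)

    core rest : List (Fin N)
    core = filter (_∈? E.carrier) order
    rest = filter (λ u → (u ∉? E.carrier) ×-dec (u ∉? L)) order

    core⁻ : ∀ {u} → u ∈ core → u ∈ E.carrier
    core⁻ u∈ = proj₂ (∈-filter⁻ (_∈? E.carrier) {xs = order} u∈)

    core⁺ : ∀ {u} → u ∈ E.carrier → u ∈ core
    core⁺ u∈ = ∈-filter⁺ (_∈? E.carrier) (covers _) u∈

    P⊆core : ∀ {x} → x ∈ P → x ∈ core
    P⊆core = core⁺ ∘ E.contains

    rest⁻ : ∀ {u} → u ∈ rest → u ∉ E.carrier × u ∉ L
    rest⁻ u∈ = proj₂ (∈-filter⁻ (λ u → (u ∉? E.carrier) ×-dec (u ∉? L)) {xs = order} u∈)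

    core-unique : Unique core
    core-unique = Unique.filter⁺ _ unique

    rest-unique : Unique rest
    rest-unique = Unique.filter⁺ _ unique

    core-bottomUp : AllPairs (λ u v → parent v ≢ just u) core
    core-bottomUp = AllPairs.filter⁺ _ bottomUp

    -- A vertex that the closure adds to `P` has children, whereas withheld leaves have none.
    core∌L : ∀ {x} → x ∈ core → x ∉ L
    core∌L x∈ x∈L with E.forced (core⁻ x∈)
    ... | inj₁ x∈P = P∌L x∈P x∈L
    ... | inj₂ two with ∈-mapMaybe⁻ parent E.carrier (count-∈ _ (≤-trans (s≤s z≤n) two))
    ...   | u , _ , eq = childless x∈L eq

    length-core : length core ≤ 2 * length P
    length-core = ≤-trans (⊆-length core-unique core⁻) E.length-carrier

    dom-cover : ∀ u → u ∈ rest ++ core ⊎ u ∈ L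
    dom-cover u with u ∈? E.carrier | u ∈? L
    ... | yes p | _ = inj₁ (∈-++⁺ʳ rest (core⁺ p))
    ... | no _ | yes q = inj₂ q
    ... | no p | no q = inj₁ (∈-++⁺ˡ (∈-filter⁺ (λ u → (u ∉? E.carrier) ×-dec (u ∉? L)) (covers u) (p , q)))

    dom∌L : ∀ {u} → u ∈ rest ++ core → u ∉ L
    dom∌L u∈ with ∈-++⁻ rest u∈
    ... | inj₁ p = proj₂ (rest⁻ p)
    ... | inj₂ p = core∌L p

    dom-unique : Unique (rest ++ core)
    dom-unique = Unique.++⁺ rest-unique core-unique (λ (p , q) → proj₁ (rest⁻ p) (core⁻ q))

    length-dom : length (rest ++ core) + length L ≤ N
    length-dom = ≤-trans (≤-reflexive (sym (length-++ (rest ++ core))))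
      (Unique⇒length≤ (Unique.++⁺ dom-unique uL (λ (p , q) → dom∌L p q)))

    core-children : ∀ {u} → u ∉ E.carrier → length (children u core) ≤ 1
    core-children {u} u∉ = length≤1 (Unique.filter⁺ isChild? core-unique) same
      where
      isChild? : Decidable (λ w → parent w ≡ just u)
      isChild? w = ≡-dec Fin._≟_ (parent w) (just u)
      same : ∀ {x y} → x ∈ children u core → y ∈ children u core → x ≡ y
      same {x} {y} x∈ y∈ with x Fin.≟ y | ∈-filter⁻ isChild? {xs = core} x∈ | ∈-filter⁻ isChild? {xs = core} y∈
      ... | yes x≡y | _ | _ = x≡y
      ... | no x≢y | x∈c , px | y∈c , py = ⊥-elim (<⇒≱ (count-pair parent E.carrier (core⁻ x∈c) (core⁻ y∈c) x≢y px py) (E.closed u∉))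

    module Rest (W : List (Fin n)) (W≤ : length W ≤ j) where

      Open? : Decidable (λ h → t ≤ toℕ h × count h targets ≤ 8 * (t * t) × h ∉ W)
      Open? h = (t ≤? toℕ h) ×-dec (count h targets ≤? 8 * (t * t)) ×-dec (h ∉? W)

      avail : List (Fin n)
      avail = filter Open? (allFin n)

      ∈avail⁻ : ∀ {h} → h ∈ avail → t ≤ toℕ h × count h targets ≤ 8 * (t * t) × h ∉ W
      ∈avail⁻ h∈ = proj₂ (∈-filter⁻ Open? {xs = allFin n} h∈)

      length-avail : n ≤ length avail + (t + (length heavy + j))
      length-avail = ≤-trans (cover-length avail (reserved ++ (heavy ++ W)) cover)
        (+-monoʳ-≤ (length avail) (≤-trans (≤-reflexive (trans (length-++ reserved) (cong (length reserved +_) (length-++ heavy))))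
          (+-mono-≤ (length-below {n} t) (+-monoʳ-≤ (length heavy) W≤))))
        where
        cover : ∀ h → h ∈ avail ⊎ h ∈ reserved ++ (heavy ++ W)
        cover h with t ≤? toℕ h | count h targets ≤? 8 * (t * t) | h ∈? W
        ... | yes p | yes q | no w = inj₁ (∈-filter⁺ Open? (∈-allFin h) (p , q , w))
        ... | no p | _ | _ = inj₂ (∈-++⁺ˡ (∈-filter⁺ (λ h → toℕ h <? t) (∈-allFin h) (≰⇒> p)))
        ... | yes _ | no q | _ = inj₂ (∈-++⁺ʳ reserved (∈-++⁺ˡ
              (∈-filter⁺ (λ h → 8 * (t * t) <? count h targets) (∈-allFin h) (≰⇒> q))))
        ... | yes _ | yes _ | yes w = inj₂ (∈-++⁺ʳ reserved (∈-++⁺ʳ heavy w))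

      -- A vertex outside the core has at most one child in it, whence `k = 1`. At least n - t -
      -- |heavy| - j hosts are available, and at most N - |L| vertices are placed in all. Since N +
      -- j = n, the room needed is |heavy| + 8t² + 5s + 1 + j ≤ |L|, which is `heavy-greedy` with
      -- its final 1 spent on the lost root leaf.
      placeRest : ∀ {f} → Good f core → (∀ {u} → u ∈ core → length (nbrs (f u)) ≤ 4 * s) →
        ∃[ f′ ] (Good f′ (rest ++ core) × (∀ {x} → x ∈ core → f′ x ≡ f x) × (∀ {u} → u ∈ rest → f′ u ∈ avail))
      placeRest g low≤ = placeAll {δ = j + 8 * (t * t)} {κ = 4 * s} {k = 1} (λ _ → avail)
        (λ _ → Unique.filter⁺ Open? (Unique.allFin⁺ n))
        rest g rest-unique (AllPairs.filter⁺ _ bottomUp)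
        (λ u∈ u∈c → proj₁ (rest⁻ u∈) (core⁻ u∈c))
        (λ u∈ → ≤-trans (low≤ u∈) 4s≤)
        (λ w∈ _ _ → low≤ w∈)
        (λ u∈ → core-children (proj₁ (rest⁻ u∈)))
        (λ _ {h} h∈ → ≤-trans (length-nbrs h) (+-monoʳ-≤ j (proj₁ (proj₂ (∈avail⁻ h∈)))))
        (λ _ → room)
        where
        open ≤-Reasoning
        4s≤ : 4 * s ≤ j + 8 * (t * t)
        4s≤ = begin
          4 * s            ≤⟨ *-mono-≤ {4} {8} (s≤s (s≤s (s≤s (s≤s z≤n)))) (≤-trans (n≤1+n s) (m≤m*n t t)) ⟩
          8 * (t * t)      ≤⟨ m≤n+m _ j ⟩
          j + 8 * (t * t)  ∎
        room : length rest + length core + (j + 8 * (t * t) + 1 * (4 * s)) ≤ length avail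
        room = +-cancelʳ-≤ (t + (length heavy + j)) _ _ (begin
          length rest + length core + (j + 8 * (t * t) + 1 * (4 * s)) + (t + (length heavy + j))
            ≡⟨ shuffle (length rest + length core) (length heavy) s (8 * (t * t)) j ⟩
          length rest + length core + (length heavy + 8 * (t * t) + (s * 5 + 1) + j) + j
            ≤⟨ +-monoˡ-≤ j (+-monoʳ-≤ (length rest + length core) enough) ⟩
          length rest + length core + length L + j
            ≡⟨ cong (λ m → m + length L + j) (sym (length-++ rest)) ⟩
          length (rest ++ core) + length L + j
            ≤⟨ +-monoˡ-≤ j length-dom ⟩
          N + j
            ≡⟨ N+j≡n ⟩
          n
            ≤⟨ length-avail ⟩
          length avail + (t + (length heavy + j)) ∎)
          where
          shuffle : ∀ a h s d j → a + (j + d + 1 * (4 * s)) + (suc s + (h + j)) ≡ a + (h + d + (s * 5 + 1) + j) + j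
          shuffle = solve-∀
          enough : length heavy + 8 * (t * t) + (s * 5 + 1) + j ≤ length L
          enough = ≤-pred (begin
            suc (length heavy + 8 * (t * t) + (s * 5 + 1) + j) ≡⟨ +-comm 1 _ ⟩
            length heavy + 8 * (t * t) + (s * 5 + 1) + j + 1
              ≤⟨ +-monoˡ-≤ 1 (+-monoˡ-≤ j (+-monoʳ-≤ (length heavy + 8 * (t * t)) five)) ⟩
            length heavy + 8 * (t * t) + 5 * t + j + 1 ≤⟨ heavy-greedy ⟩
            r ≤⟨ r≤ ⟩
            suc (length L) ∎)
            where
            five : s * 5 + 1 ≤ 5 * t
            five = ≤-trans (m≤m+n (s * 5 + 1) 4) (≤-reflexive (eq s))
              where
              eq : ∀ s → s * 5 + 1 + 4 ≡ 5 * suc s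
              eq = solve-∀

-- The arithmetic behind the constant 1/4.

slack : ∀ {a b} c → a + c ≡ b → a ≤ b
slack {a} c eq = ≤-trans (m≤m+n a c) (≤-reflexive eq)

cube-cancel-≤ : ∀ {x y} → x ^ 3 ≤ y ^ 3 → x ≤ y
cube-cancel-≤ {x} {y} le with x ≤? y
... | yes p = p
... | no ¬p = ⊥-elim (<⇒≱ (^-monoˡ-< 3 (≰⇒> ¬p)) le)

-- Writing n = 64 t³ + a and b = a / 8t, the bound r = 16 t² + b is a linear lower bound for
-- n^{2/3} between consecutive values of t.
module Arith (n s : ℕ) (s≥ : 20 ≤ s) (lower : (4 * suc s) ^ 3 ≤ n) (upper : n < (4 * suc (suc s)) ^ 3) where
  open ≤-Reasoning

  t = suc s
  a = n ∸ 64 * (t * (t * t))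
  b = a / (8 * t)
  r = 16 * (t * t) + b

  cube : ∀ t → (4 * t) ^ 3 ≡ 64 * (t * (t * t))
  cube = expand
    where
    expand : ∀ t → (4 * t) * ((4 * t) * ((4 * t) * 1)) ≡ 64 * (t * (t * t))
    expand = solve-∀

  lower′ : 64 * (t * (t * t)) ≤ n
  lower′ = subst (_≤ n) (cube t) lower

  n-eq : n ≡ 64 * (t * (t * t)) + a
  n-eq = sym (m+[n∸m]≡n lower′)

  b-lower : b * (8 * t) ≤ a
  b-lower = ≤-trans (m≤n+m (b * (8 * t)) (a % (8 * t))) (≤-reflexive (sym (m≡m%n+[m/n]*n a (8 * t))))

  b-upper : suc a ≤ suc b * (8 * t)
  b-upper = begin-strict
    a                             ≡⟨ m≡m%n+[m/n]*n a (8 * t) ⟩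
    a % (8 * t) + b * (8 * t)     <⟨ +-monoˡ-< (b * (8 * t)) (m%n<n a (8 * t)) ⟩
    8 * t + b * (8 * t)           ∎

  a-upper : a ≤ 192 * (t * t) + 192 * t + 64
  a-upper = +-cancelˡ-≤ (64 * (t * (t * t))) _ _ (begin
    64 * (t * (t * t)) + a ≡⟨ sym n-eq ⟩
    n                      ≤⟨ <⇒≤ upper ⟩
    (4 * suc t) ^ 3        ≡⟨ cube (suc t) ⟩
    64 * (suc t * (suc t * suc t)) ≡⟨ eq t ⟩
    64 * (t * (t * t)) + (192 * (t * t) + 192 * t + 64) ∎)
    where
    eq : ∀ t → 64 * (suc t * (suc t * suc t)) ≡ 64 * (t * (t * t)) + (192 * (t * t) + 192 * t + 64)
    eq = solve-∀

  s-eq : s ≡ 20 + (s ∸ 20)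
  s-eq = sym (m+[n∸m]≡n s≥)

  b≤ : b ≤ 24 * t + 25
  b≤ = *-cancelʳ-≤ b (24 * t + 25) (8 * t) (begin
    b * (8 * t)                    ≤⟨ b-lower ⟩
    a                              ≤⟨ a-upper ⟩
    192 * (t * t) + 192 * t + 64   ≤⟨ subst (λ s →
      192 * (suc s * suc s) + 192 * suc s + 64 ≤ (24 * suc s + 25) * (8 * suc s))
      (sym s-eq) (slack (8 * u + 104) (eq u)) ⟩
    (24 * t + 25) * (8 * t)        ∎)
    where
    u = s ∸ 20
    eq : ∀ u → 192 * (suc (20 + u) * suc (20 + u)) + 192 * suc (20 + u) + 64 + (8 * u + 104)
      ≡ (24 * suc (20 + u) + 25) * (8 * suc (20 + u))
    eq = solve-∀

  r-upper : r ≤ 18 * (t * t)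
  r-upper = begin
    16 * (t * t) + b             ≤⟨ +-monoʳ-≤ (16 * (t * t)) b≤ ⟩
    16 * (t * t) + (24 * t + 25) ≤⟨ subst (λ s →
      16 * (suc s * suc s) + (24 * suc s + 25) ≤ 18 * (suc s * suc s))
      (sym s-eq) (slack (2 * (u * u) + 60 * u + 353) (eq u)) ⟩
    18 * (t * t)                 ∎
    where
    u = s ∸ 20
    eq : ∀ u → 16 * (suc (20 + u) * suc (20 + u)) + (24 * suc (20 + u) + 25) + (2 * (u * u) + 60 * u + 353)
      ≡ 18 * (suc (20 + u) * suc (20 + u))
    eq = solve-∀

  manyLeaves : ∀ {x} → n ^ 2 ≤ x ^ 3 → r ≤ x
  manyLeaves {x} le = cube-cancel-≤ (begin
    r ^ 3                                     ≤⟨ poly ⟩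
    (64 * (t * (t * t)) + b * (8 * t)) ^ 2    ≤⟨ ^-monoˡ-≤ 2 (+-monoʳ-≤ (64 * (t * (t * t))) b-lower) ⟩
    (64 * (t * (t * t)) + a) ^ 2              ≡⟨ cong (_^ 2) (sym n-eq) ⟩
    n ^ 2                                     ≤⟨ le ⟩
    x ^ 3                                     ∎)
    where
    -- The two sides differ by 256 t⁴ b + 16 t² b² − b³, and b ≤ 16 t².
    b≤16tt : b ≤ 16 * (t * t)
    b≤16tt = ≤-trans b≤ (subst (λ s → 24 * suc s + 25 ≤ 16 * (suc s * suc s))
      (sym s-eq) (slack (16 * (u * u) + 648 * u + 6527) (eq u)))
      where
      u = s ∸ 20
      eq : ∀ u → 24 * suc (20 + u) + 25 + (16 * (u * u) + 648 * u + 6527) ≡ 16 * (suc (20 + u) * suc (20 + u))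
      eq = solve-∀
    expand : ∀ t b c → 16 * (t * t) ≡ b + c →
      (16 * (t * t) + b) ^ 3 + (256 * (t * (t * (t * (t * b)))) + c * (b * b)) ≡ (64 * (t * (t * t)) + b * (8 * t)) ^ 2
    expand t b c eq = trans (lhs t b c) (trans (cong (λ m → 4096 * (t * (t * (t * (t * (t * t)))))
      + 1024 * (t * (t * (t * (t * b)))) + 48 * (t * t) * (b * b) + m * (b * b)) (sym eq)) (rhs t b))
      where
      lhs : ∀ t b c → (16 * (t * t) + b) * ((16 * (t * t) + b) * ((16 * (t * t) + b) * 1))
        + (256 * (t * (t * (t * (t * b)))) + c * (b * b))
        ≡ 4096 * (t * (t * (t * (t * (t * t))))) + 1024 * (t * (t * (t * (t * b)))) + 48 * (t * t) * (b * b) + (b + c) * (b * b)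
      lhs = solve-∀
      rhs : ∀ t b → 4096 * (t * (t * (t * (t * (t * t)))))
        + 1024 * (t * (t * (t * (t * b)))) + 48 * (t * t) * (b * b) + 16 * (t * t) * (b * b)
        ≡ (64 * (t * (t * t)) + b * (8 * t)) * ((64 * (t * (t * t)) + b * (8 * t)) * 1)
      rhs = solve-∀
    poly : r ^ 3 ≤ (64 * (t * (t * t)) + b * (8 * t)) ^ 2
    poly = slack _ (expand t b (16 * (t * t) ∸ b) (sym (m+[n∸m]≡n b≤16tt)))

  -- If x = 4t + y then n − 64 t³ ≥ 48 t² y, hence b ≥ 6 t y.
  fewParents : ∀ {x} → x ^ 3 ≤ n → x * (4 * s) + 2 ≤ r × x ≤ 4 * t + 4
  fewParents {x} le = bound , x≤
    where
    x≤ : x ≤ 4 * t + 4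
    x≤ = ≤-trans (cube-cancel-≤ (≤-trans le (<⇒≤ upper))) (≤-reflexive (eq s))
      where
      eq : ∀ s → 4 * suc (suc s) ≡ 4 * suc s + 4
      eq = solve-∀
    base : 4 * t * (4 * s) + 2 ≤ 16 * (t * t)
    base = slack (16 * s + 14) (eq s)
      where
      eq : ∀ s → 4 * suc s * (4 * s) + 2 + (16 * s + 14) ≡ 16 * (suc s * suc s)
      eq = solve-∀
    bound : x * (4 * s) + 2 ≤ r
    bound with x ≤? 4 * t
    ... | yes p = ≤-trans (+-monoˡ-≤ 2 (*-monoˡ-≤ (4 * s) p)) (≤-trans base (m≤m+n _ b))
    ... | no ¬p = begin
      x * (4 * s) + 2               ≡⟨ cong (λ x → x * (4 * s) + 2) (sym x-eq) ⟩
      (4 * t + y) * (4 * s) + 2     ≡⟨ regroup t y s ⟩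
      (4 * t * (4 * s) + 2) + y * (4 * s) ≤⟨ +-mono-≤ base yb ⟩
      16 * (t * t) + b              ∎
      where
      y = x ∸ 4 * t
      x-eq : 4 * t + y ≡ x
      x-eq = m+[n∸m]≡n (≰⇒≥ ¬p)
      regroup : ∀ t y s → (4 * t + y) * (4 * s) + 2 ≡ (4 * t * (4 * s) + 2) + y * (4 * s)
      regroup = solve-∀
      a≥ : 48 * (t * t) * y ≤ a
      a≥ = +-cancelˡ-≤ (64 * (t * (t * t))) _ _ (begin
        64 * (t * (t * t)) + 48 * (t * t) * y ≤⟨ slack _ (eq t y) ⟩
        (4 * t + y) ^ 3                       ≡⟨ cong (_^ 3) x-eq ⟩
        x ^ 3                                 ≤⟨ le ⟩
        n                                     ≡⟨ n-eq ⟩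
        64 * (t * (t * t)) + a                ∎)
        where
        eq : ∀ t y → 64 * (t * (t * t)) + 48 * (t * t) * y + (12 * t * (y * y) + y * (y * y))
          ≡ (4 * t + y) * ((4 * t + y) * ((4 * t + y) * 1))
        eq = solve-∀
      yb : y * (4 * s) ≤ b
      yb = ≤-pred (*-cancelʳ-< (8 * t) (y * (4 * s)) (suc b) (begin-strict
        y * (4 * s) * (8 * t)  ≤⟨ slack (16 * (y * (t * t)) + 32 * (y * t)) (eq y s) ⟩
        48 * (t * t) * y       ≤⟨ a≥ ⟩
        a                      <⟨ b-upper ⟩
        suc b * (8 * t)        ∎))
        where
        eq : ∀ y s → y * (4 * s) * (8 * suc s) + (16 * (y * (suc s * suc s)) + 32 * (y * suc s)) ≡ 48 * (suc s * suc s) * y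
        eq = solve-∀

  -- From n ≤ 64t³ + 8t(b + 1) and j ≤ s one gets ht ≤ 8t²s + s(b + 1), and s < t makes this h ≤ 8ts
  -- + b. Adding the degree bound 8t² gives 16t² + b - 8t, which leaves 8t for the lower-order
  -- terms. The threshold 8t² balances the number of heavy hosts, roughly jn / 8t², against the
  -- degree of the other ones.
  greedy : ∀ {h j} → j ≤ s → h * suc (8 * (t * t)) ≤ j * n → h + 8 * (t * t) + 5 * t + j + 1 ≤ r
  greedy {h} {j} j≤s le = begin
    h + 8 * (t * t) + 5 * t + j + 1             ≤⟨ +-monoˡ-≤ 1 (+-mono-≤ (+-monoˡ-≤ (5 * t) (+-monoˡ-≤ (8 * (t * t)) h≤)) j≤s) ⟩
    (8 * (t * s) + b) + 8 * (t * t) + 5 * t + s + 1  ≤⟨ slack (2 * t) (eq s b) ⟩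
    16 * (t * t) + b                            ∎
    where
    eq : ∀ s b → (8 * (suc s * s) + b) + 8 * (suc s * suc s) + 5 * suc s + s + 1 + 2 * suc s ≡ 16 * (suc s * suc s) + b
    eq = solve-∀
    ht≤ : h * t ≤ 8 * (t * (t * s)) + s * suc b
    ht≤ = *-cancelʳ-≤ (h * t) (8 * (t * (t * s)) + s * suc b) (8 * t) (begin
      h * t * (8 * t)                  ≡⟨ e₁ h t ⟩
      h * (8 * (t * t))                ≤⟨ *-monoʳ-≤ h (n≤1+n _) ⟩
      h * suc (8 * (t * t))            ≤⟨ le ⟩
      j * n                            ≤⟨ *-mono-≤ j≤s (≤-trans (≤-reflexive n-eq) (+-monoʳ-≤ (64 * (t * (t * t))) (<⇒≤ b-upper))) ⟩
      s * (64 * (t * (t * t)) + suc b * (8 * t)) ≡⟨ e₂ s t (suc b) ⟩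
      (8 * (t * (t * s)) + s * suc b) * (8 * t) ∎)
      where
      e₁ : ∀ h t → h * t * (8 * t) ≡ h * (8 * (t * t))
      e₁ = solve-∀
      e₂ : ∀ s t c → s * (64 * (t * (t * t)) + c * (8 * t)) ≡ (8 * (t * (t * s)) + s * c) * (8 * t)
      e₂ = solve-∀
    h≤ : h ≤ 8 * (t * s) + b
    h≤ = ≤-pred (*-cancelʳ-< t h (suc (8 * (t * s) + b)) (begin-strict
      h * t                              ≤⟨ ht≤ ⟩
      8 * (t * (t * s)) + s * suc b      <⟨ +-monoʳ-< (8 * (t * (t * s))) (*-monoˡ-< (suc b) (n<1+n s)) ⟩
      8 * (t * (t * s)) + t * suc b      ≡⟨ e t s b ⟩
      suc (8 * (t * s) + b) * t          ∎))
      where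
      e : ∀ t s b → 8 * (t * (t * s)) + t * suc b ≡ suc (8 * (t * s) + b) * t
      e = solve-∀

  sizes : Sizes n s r
  sizes = record { s-pos = s≥ ; n-lower = lower′ ; r-lower = m≤m+n _ b ; r-upper = r-upper
                 ; manyLeaves = manyLeaves ; fewParents = fewParents ; greedy = greedy }

-- Completing the embedding of one tree; few parents.

length-∉ : ∀ {k} {xs : List (Fin k)} ys → Unique xs → length xs ≤ length (filter (_∉? ys) xs) + length ys
length-∉ {xs = xs} ys uq = ≤-trans (⊆-length uq cover) (≤-reflexive (length-++ (filter (_∉? ys) xs)))
  where
  cover : ∀ {x} → x ∈ xs → x ∈ filter (_∉? ys) xs ++ ys
  cover {x} x∈ with x ∈? ys
  ... | yes x∈ys = ∈-++⁺ʳ _ x∈ys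
  ... | no x∉ys = ∈-++⁺ˡ (∈-filter⁺ (_∉? ys) x∈ x∉ys)

module Completion {n N s r : ℕ} (sizes : Sizes n s r) (πs : List (Fin n → Maybe (Fin n)))
  (j≤s : length πs ≤ s) (N+j≡n : N + length πs ≡ n)
  {G : Graph N} (R : Rooting G) where

  open Step sizes πs j≤s N+j≡n R public

  Reserved : Fin n → Set
  Reserved h = j < toℕ h × toℕ h < t

  -- The field `free` keeps vertices with children away from the hosts reserved for later trees.
  -- Such a host then receives at most one edge from each tree until its own turn.
  record Placement : Set where
    field
      to        : Fin N → Fin n
      injective : ∀ {u w} → to u ≡ to w → u ≡ w
      edges     : ∀ {u w} → parent u ≡ just w → ¬ Used (to u) (to w)
      free      : ∀ {u w} → parent u ≡ just w → ¬ Reserved (to w)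

  ≥t⇒free : ∀ {h} → t ≤ toℕ h → ¬ Reserved h
  ≥t⇒free t≤h (_ , h<t) = <⇒≱ h<t t≤h

  -- Here `k = 0`: the whole list is bottom-up, so no vertex of `dom` is a child of one in `us`, and
  -- only the host of the parent, of degree at most 4s, excludes hosts by adjacency.
  placeSegment : ∀ (allowed : Fin N → List (Fin n)) us {dom f} → Good f dom →
    Unique (us ++ dom) → AllPairs (λ u v → parent v ≢ just u) (us ++ dom) →
    (∀ {w} → w ∈ dom → length (nbrs (f w)) ≤ 4 * s) →
    (∀ u → Unique (allowed u)) → (∀ {u h} → u ∈ us → h ∈ allowed u → length (nbrs h) ≤ 4 * s) →
    (∀ {u} → u ∈ us → length (us ++ dom) + 4 * s ≤ length (allowed u)) →
    ∃[ f′ ] (Good f′ (us ++ dom) × (∀ {x} → x ∈ dom → f′ x ≡ f x) × (∀ {u} → u ∈ us → f′ u ∈ allowed u))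
  placeSegment allowed us {dom} g uq bu low≤ uqA aLow room with allPairs-++⁻ us uq | allPairs-++⁻ us bu
  ... | u-us , _ , disj | b-us , _ , b-cross = placeAll {δ = 4 * s} {κ = 4 * s} {k = 0} allowed uqA us g u-us b-us
    (λ u∈ u∈dom → disj u∈ u∈dom refl) low≤ (λ w∈ _ _ → low≤ w∈)
    (λ u∈ → ≤-reflexive (cong length (filter-none (λ w → ≡-dec Fin._≟_ (parent w) (just _))
      (All.tabulate (λ w∈ → b-cross u∈ w∈)))))
    (λ u∈ h∈ → aLow u∈ h∈)
    (λ u∈ → ≤-trans (≤-reflexive (cong₂ _+_ (sym (length-++ us)) (+-identityʳ (4 * s)))) (room u∈))

  module Final (L P : List (Fin N)) (pa : Fin N → Fin N) (uL : Unique L) (uP : Unique P)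
    (parent-L : ∀ {l} → l ∈ L → parent l ≡ just (pa l)) (childless : ∀ {u l} → l ∈ L → parent u ≢ just l)
    (P∌L : ∀ {x} → x ∈ P → x ∉ L) (pa∈P : ∀ {l} → l ∈ L → pa l ∈ P) (r≤ : r ≤ suc (length L)) where

    open Leaves L P pa uL uP parent-L childless P∌L pa∈P r≤ public

    base : List (Fin N)
    base = rest ++ core

    -- `D` holds leaves placed in advance, `W` the hosts that this tree omits, and `L₀` the partners
    -- for exchanges. Omitting j hosts is affordable because the tree has j vertices fewer than
    -- there are hosts.
    conclude : ∀ {f} D W L₀ → Good f (D ++ base) → Unique D → (∀ {l} → l ∈ D → l ∈ L) →
      (∀ {u} → u ∈ core → length (nbrs (f u)) ≤ 4 * s) → (∀ {u} → u ∈ base → ¬ Reserved (f u)) →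
      length W ≤ j → Unique L₀ → (∀ {l} → l ∈ L₀ → l ∈ L × l ∉ D) →
      (∀ {z} → z ∉ map f (D ++ base) → z ∉ W → 4 * s < length (filter (λ l → z ∉? nbrs (f (pa l))) L₀)) →
      Placement
    conclude {f} D W L₀ g uD D⊆L low≤ free W≤ u₀ L₀⊆ many = result
      (finish Ls Z pa L₀ g uLs (Unique.filter⁺ Z? (Unique.allFin⁺ n)) u₀ cover (proj₁ ∘ ∈Z⁻) lenLs leaf
        (λ l∈ → childless (proj₁ (∈Ls⁻ l∈)))
        (λ l∈ → let l∈L , l∉D = L₀⊆ l∈ in ∈-filter⁺ (_∉? D) l∈L l∉D)
        (λ z∈ → let z∉ , z∉W = ∈Z⁻ z∈ in many z∉ z∉W))
      where
      dom = D ++ base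
      Ls = filter (_∉? D) L
      Z? : Decidable (λ h → h ∉ map f dom × h ∉ W)
      Z? h = (h ∉? map f dom) ×-dec (h ∉? W)
      Z = filter Z? (allFin n)
      ∈Z⁻ : ∀ {z} → z ∈ Z → z ∉ map f dom × z ∉ W
      ∈Z⁻ z∈ = proj₂ (∈-filter⁻ Z? {xs = allFin n} z∈)
      ∈Ls⁻ : ∀ {l} → l ∈ Ls → l ∈ L × l ∉ D
      ∈Ls⁻ l∈ = ∈-filter⁻ (_∉? D) {xs = L} l∈
      uLs : Unique Ls
      uLs = Unique.filter⁺ _ uL
      Ls∌dom : ∀ {l} → l ∈ Ls → l ∉ dom
      Ls∌dom l∈ l∈dom with ∈-++⁻ D l∈dom
      ... | inj₁ l∈D = proj₂ (∈Ls⁻ l∈) l∈D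
      ... | inj₂ l∈base = dom∌L l∈base (proj₁ (∈Ls⁻ l∈))
      cover : ∀ u → u ∈ dom ⊎ u ∈ Ls
      cover u with u ∈? D | dom-cover u
      ... | yes u∈D | _ = inj₁ (∈-++⁺ˡ u∈D)
      ... | no _ | inj₁ u∈ = inj₁ (∈-++⁺ʳ D u∈)
      ... | no u∉D | inj₂ u∈L = inj₂ (∈-filter⁺ (_∉? D) u∈L u∉D)
      udom : Unique dom
      udom = Unique.++⁺ uD dom-unique (λ (u∈D , u∈b) → dom∌L u∈b (D⊆L u∈D))
      lenLs : length Ls ≤ length Z
      lenLs = +-cancelʳ-≤ (length dom + j) _ _ (begin
        length Ls + (length dom + j)        ≡⟨ sym (+-assoc (length Ls) _ j) ⟩
        length Ls + length dom + j          ≡⟨ cong (_+ j) (sym (length-++ Ls)) ⟩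
        length (Ls ++ dom) + j              ≤⟨ +-monoˡ-≤ j (Unique⇒length≤ (Unique.++⁺ uLs udom (λ (p , q) → Ls∌dom p q))) ⟩
        N + j                               ≡⟨ N+j≡n ⟩
        n                                   ≤⟨ cover-length Z (map f dom ++ W) coverZ ⟩
        length Z + length (map f dom ++ W)  ≡⟨ cong (length Z +_)
          (trans (length-++ (map f dom)) (cong (_+ length W) (length-map f dom))) ⟩
        length Z + (length dom + length W)  ≤⟨ +-monoʳ-≤ (length Z) (+-monoʳ-≤ (length dom) W≤) ⟩
        length Z + (length dom + j)         ∎)
        where
        open ≤-Reasoning
        coverZ : ∀ h → h ∈ Z ⊎ h ∈ map f dom ++ W
        coverZ h with h ∈? map f dom | h ∈? W
        ... | yes p | _ = inj₂ (∈-++⁺ˡ p)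
        ... | no _ | yes q = inj₂ (∈-++⁺ʳ (map f dom) q)
        ... | no p | no q = inj₁ (∈-filter⁺ Z? (∈-allFin h) (p , q))
      leaf : ∀ {l} → l ∈ Ls → l ∉ dom × parent l ≡ just (pa l) × pa l ∈ dom × length (nbrs (f (pa l))) ≤ 4 * s
      leaf l∈ with ∈Ls⁻ l∈
      ... | l∈L , _ = Ls∌dom l∈ , parent-L l∈L , ∈-++⁺ʳ D (∈-++⁺ʳ rest (P⊆core (pa∈P l∈L))) , low≤ (P⊆core (pa∈P l∈L))
      result : Extension f dom → Placement
      result ext = record { to = X.to ; injective = X.injective ; edges = X.edges ; free = free′ }
        where
        module X = Extension ext
        free′ : ∀ {u w} → parent u ≡ just w → ¬ Reserved (X.to w)
        free′ {u} {w} eq with dom-cover w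
        ... | inj₂ w∈L = ⊥-elim (childless w∈L eq)
        ... | inj₁ w∈ rewrite X.keeps (∈-++⁺ʳ D w∈) = free w∈

    -- x is placed at the host v, whose used neighbours W are avoided by this tree.
    module FewParents (v : Fin n) (v≡j : toℕ v ≡ j) (nv : length (nbrs v) ≤ j) (x : Fin N) (x∈P : x ∈ P)
      (many : 4 * s < length (filter (λ l → pa l Fin.≟ x) L))
      (room : length core + 4 * s + j ≤ length low) where

      W = nbrs v
      allowed = filter (_∉? W) low

      allowed⁻ : ∀ {h} → h ∈ allowed → h ∈ low × h ∉ W
      allowed⁻ = ∈-filter⁻ (_∉? W) {xs = low}

      room′ : length core + 4 * s ≤ length allowed
      room′ = +-cancelʳ-≤ j _ _ (≤-trans room (≤-trans (length-∉ W low-unique) (+-monoʳ-≤ (length allowed) nv)))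

      open Rest W nv

      OK : Fin n → Set
      OK h = h ∈ allowed ⊎ h ≡ v

      OK-low : ∀ {h} → OK h → length (nbrs h) ≤ 4 * s
      OK-low (inj₁ a) = proj₂ (∈low⁻ (proj₁ (allowed⁻ a)))
      OK-low (inj₂ refl) = ≤-trans nv (≤-trans j≤s (m≤n*m s 4))

      OK-free : ∀ {h} → OK h → ¬ Reserved h
      OK-free (inj₁ a) = ≥t⇒free (proj₁ (∈low⁻ (proj₁ (allowed⁻ a))))
      OK-free (inj₂ refl) (j<v , _) = <-irrefl (sym v≡j) j<v

      CorePlaced : Set
      CorePlaced = ∃[ f ] (Good f core × (f x ≡ v) × (∀ {u} → u ∈ core → OK (f u)))

      placeCore : CorePlaced
      placeCore = go (∈-∃++ (P⊆core x∈P))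
        where
        go : (∃[ E₂ ] ∃[ E₁ ] (core ≡ E₂ ++ x ∷ E₁)) → CorePlaced
        -- The placement runs from the end of the core: first `E₁`, then `x` at `v`, then `E₂`. The
        -- constant function stands for the empty placement.
        go (E₂ , E₁ , eq) = stage₁ (placeSegment (λ _ → allowed) E₁ {[]} {λ _ → v} (record { inj = λ () ; edge = λ () })
            (subst Unique (sym (++-identityʳ E₁)) u₁)
            (subst (AllPairs _) (sym (++-identityʳ E₁)) b₁)
            (λ ()) (λ _ → Unique.filter⁺ _ low-unique) (λ _ h∈ → proj₂ (∈low⁻ (proj₁ (allowed⁻ h∈))))
            (λ _ → ≤-trans (+-monoˡ-≤ (4 * s) lenE₁) room′))
          where
          uq : Unique (E₂ ++ x ∷ E₁)
          uq = subst Unique eq core-unique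
          bu : AllPairs (λ u v → parent v ≢ just u) (E₂ ++ x ∷ E₁)
          bu = subst (AllPairs _) eq core-bottomUp
          lenE : length (E₂ ++ x ∷ E₁) ≡ length core
          lenE = cong length (sym eq)
          lenE₁ : length (E₁ ++ []) ≤ length core
          lenE₁ = ≤-trans (≤-reflexive (cong length (++-identityʳ E₁)))
            (≤-trans (n≤1+n _) (≤-trans (length-++-≤ʳ (x ∷ E₁) {E₂}) (≤-reflexive lenE)))
          u₁ : Unique E₁
          u₁ with allPairs-++⁻ E₂ uq
          ... | _ , (_ ∷ u) , _ = u
          x∉E₁ : x ∉ E₁
          x∉E₁ x∈ with allPairs-++⁻ E₂ uq
          ... | _ , (x# ∷ _) , _ = All.lookup x# x∈ refl
          b₁ : AllPairs (λ u v → parent v ≢ just u) E₁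
          b₁ with allPairs-++⁻ E₂ bu
          ... | _ , (_ ∷ b) , _ = b
          stage₁ : ∃[ f′ ] (Good f′ (E₁ ++ []) × (∀ {y} → y ∈ [] → f′ y ≡ v) × (∀ {u} → u ∈ E₁ → f′ u ∈ allowed)) → CorePlaced
          stage₁ (f₁ , g₁′ , _ , ok₁) = stage₂ (placeSegment (λ _ → allowed) E₂ g₂ uq bu low≤
              (λ _ → Unique.filter⁺ _ low-unique) (λ _ h∈ → proj₂ (∈low⁻ (proj₁ (allowed⁻ h∈))))
              (λ _ → ≤-trans (≤-reflexive (cong (_+ 4 * s) lenE)) room′))
            where
            g₁ : Good f₁ E₁
            g₁ = subst (Good f₁) (++-identityʳ E₁) g₁′
            f₂ = update f₁ x v
            at-v : ∀ {h} → h ∈ allowed → h ≢ v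
            at-v h∈ refl = <⇒≱ (≤-<-trans (≤-reflexive v≡j) (s≤s j≤s)) (proj₁ (∈low⁻ (proj₁ (allowed⁻ h∈))))
            v∉ : v ∉ map f₁ E₁
            v∉ v∈ with ∈-map⁻ f₁ v∈
            ... | u , u∈ , v≡ = at-v (ok₁ u∈) (sym v≡)
            unused : ∀ {w} → w ∈ E₁ → ¬ Used (f₁ w) v
            unused w∈ used = proj₂ (allowed⁻ (ok₁ w∈)) (Used⇒∈nbrs (Used-sym used))
            -- The host `v` is vacant because its index is below `t`, and `E₁` avoids all used
            -- neighbours of `v`; so `x` can go there whichever vertices of `E₁` are adjacent to it.
            g₂ : Good f₂ (x ∷ E₁)
            g₂ = place x v g₁ x∉E₁ v∉ (λ w∈ _ → unused w∈) (λ w∈ _ → unused w∈)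
            in₂ : ∀ {w} → w ∈ x ∷ E₁ → OK (f₂ w)
            in₂ (here refl) = inj₂ (update-≡ f₁ x v)
            in₂ (there w∈) = inj₁ (subst (_∈ allowed) (sym (update-≢ f₁ v (λ w≡x → x∉E₁ (subst (_∈ E₁) w≡x w∈)))) (ok₁ w∈))
            low≤ : ∀ {w} → w ∈ x ∷ E₁ → length (nbrs (f₂ w)) ≤ 4 * s
            low≤ w∈ = OK-low (in₂ w∈)
            stage₂ : ∃[ f′ ] (Good f′ (E₂ ++ x ∷ E₁) × (∀ {y} → y ∈ x ∷ E₁ → f′ y ≡ f₂ y) ×
              (∀ {u} → u ∈ E₂ → f′ u ∈ allowed)) → CorePlaced
            stage₂ (f₃ , g₃ , keep , ok₃) = f₃ , subst (Good f₃) (sym eq) g₃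
              , trans (keep (here refl)) (update-≡ f₁ x v)
              , λ u∈ → in₃ (∈-++⁻ E₂ (subst (_ ∈_) eq u∈))
              where
              in₃ : ∀ {u} → u ∈ E₂ ⊎ u ∈ x ∷ E₁ → OK (f₃ u)
              in₃ (inj₁ u∈) = inj₁ (ok₃ u∈)
              in₃ {u} (inj₂ u∈) = subst OK (sym (keep u∈)) (in₂ u∈)

      placement : Placement
      placement = fromCore placeCore
        where
        L₀ = filter (λ l → pa l Fin.≟ x) L
        leaf⁻ : ∀ {l} → l ∈ L₀ → l ∈ L × pa l ≡ x
        leaf⁻ = ∈-filter⁻ (λ l → pa l Fin.≟ x) {xs = L}
        fromRest : ∀ {f : Fin N → Fin n} → f x ≡ v → (∀ {u} → u ∈ core → OK (f u)) →
          ∃[ f′ ] (Good f′ (rest ++ core) × (∀ {x} → x ∈ core → f′ x ≡ f x) × (∀ {u} → u ∈ rest → f′ u ∈ avail)) →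
          Placement
        fromRest {f} fx ok (f′ , g′ , keep , ok′) =
          conclude [] W L₀ g′ [] (λ ()) (OK-low ∘ okCore) (λ u∈ → free (∈-++⁻ rest u∈)) nv
            (Unique.filter⁺ _ uL) (λ l∈ → proj₁ (leaf⁻ l∈) , λ ()) suits
          where
          okCore : ∀ {u} → u ∈ core → OK (f′ u)
          okCore u∈ = subst OK (sym (keep u∈)) (ok u∈)
          free : ∀ {u} → u ∈ rest ⊎ u ∈ core → ¬ Reserved (f′ u)
          free (inj₁ u∈) = ≥t⇒free (proj₁ (∈avail⁻ (ok′ u∈)))
          free (inj₂ u∈) = OK-free (okCore u∈)
          -- All leaves in `L₀` hang from `x`, which sits at `v`, and `z` is no neighbour of `v`.
          -- Hence `z` suits every one of them.
          suits : ∀ {z} → z ∉ map f′ base → z ∉ W → 4 * s < length (filter (λ l → z ∉? nbrs (f′ (pa l))) L₀)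
          suits {z} _ z∉W = subst (4 * s <_)
              (cong length (sym (filter-all (λ l → z ∉? nbrs (f′ (pa l))) (All.tabulate suit)))) many
            where
            suit : ∀ {l} → l ∈ L₀ → z ∉ nbrs (f′ (pa l))
            suit l∈ = subst (λ h → z ∉ nbrs h)
              (sym (trans (cong f′ (proj₂ (leaf⁻ l∈))) (trans (keep (P⊆core x∈P)) fx))) z∉W
        fromCore : CorePlaced → Placement
        fromCore (f , g , fx , ok) = fromRest fx ok (placeRest g (OK-low ∘ ok))

-- Completing the embedding of one tree; independent leaves.

take-⊆ : ∀ m {x : A} xs → x ∈ take m xs → x ∈ xs
take-⊆ (suc m) (x ∷ xs) (here eq) = here eq
take-⊆ (suc m) (x ∷ xs) (there x∈) = there (take-⊆ m xs x∈)

map-≗-∈ : (f g : A → B) {xs : List A} {y : B} → (∀ {x} → x ∈ xs → f x ≡ g x) → y ∈ map g xs → y ∈ map f xs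
map-≗-∈ f g f≗g y∈ with ∈-map⁻ g y∈
... | x , x∈ , refl = subst (_∈ _) (f≗g x∈) (∈-map⁺ f x∈)

-- Since `ded` is a function, distinct hosts are promised distinct parents. The value `nothing`
-- marks a vertex without an obligation.
record Dedication {k n} (bs : List (Fin n)) (ps : List (Fin k)) : Set where
  field
    ded  : Fin k → Maybe (Fin n)
    onto : ∀ {b} → b ∈ bs → ∃[ p ] (p ∈ ps × ded p ≡ just b)
    into : ∀ {p b} → ded p ≡ just b → b ∈ bs

dedicate : ∀ {k n} (bs : List (Fin n)) (ps : List (Fin k)) → Unique ps → length bs ≤ length ps → Dedication bs ps
dedicate [] _ _ _ = record { ded = const nothing ; onto = λ () ; into = λ () }
dedicate {k} {n} (b ∷ bs) (p ∷ ps) (p# ∷ u) (s≤s le) = extend (dedicate bs ps u le)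
  where
  extend : Dedication bs ps → Dedication (b ∷ bs) (p ∷ ps)
  extend d = record { ded = update ded p (just b) ; onto = onto′ ; into = λ {q} → into′ q }
    where
    open Dedication d
    onto′ : ∀ {c} → c ∈ b ∷ bs → ∃[ q ] (q ∈ p ∷ ps × update ded p (just b) q ≡ just c)
    onto′ (here refl) = p , here refl , update-≡ ded p (just b)
    onto′ (there c∈) with onto c∈
    ... | q , q∈ , eq = q , there q∈ , trans (update-≢ ded (just b) (λ q≡p → All.lookup p# q∈ (sym q≡p))) eq
    into′ : ∀ q {c} → update ded p (just b) q ≡ just c → c ∈ b ∷ bs
    into′ q eq with q Fin.≟ p
    ... | yes _ = here (sym (just-injective eq))
    ... | no _ = there (into eq)

count-concatMap : ∀ {k} z (g : A → List (Fin k)) xs →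
  length (filter (λ x → z ∈? g x) xs) ≤ count z (concatMap g xs)
count-concatMap z g [] = z≤n
count-concatMap z g (x ∷ xs) = ≤-trans (step (z ∈? g x)) (≤-reflexive (sym (count-++ z (g x) _)))
  where
  one : ∀ ys → z ∈ ys → 1 ≤ count z ys
  one ys z∈ = nonempty (∈-filter⁺ (z Fin.≟_) z∈ refl)
    where
    nonempty : ∀ {zs : List (Fin _)} → z ∈ zs → 1 ≤ length zs
    nonempty (here _) = s≤s z≤n
    nonempty (there _) = s≤s z≤n
  step : Dec (z ∈ g x) → length (filter (λ x → z ∈? g x) (x ∷ xs)) ≤ count z (g x) + count z (concatMap g xs)
  step (yes z∈) rewrite filter-accept (λ x → z ∈? g x) {xs = xs} z∈ = +-mono-≤ (one (g x) z∈) (count-concatMap z g xs)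
  step (no z∉) rewrite filter-reject (λ x → z ∈? g x) {xs = xs} z∉ = ≤-trans (count-concatMap z g xs) (m≤n+m _ _)

module Independent {n N s r : ℕ} (sizes : Sizes n s r) (πs : List (Fin n → Maybe (Fin n)))
  (j≤s : length πs ≤ s) (N+j≡n : N + length πs ≡ n)
  {G : Graph N} (R : Rooting G)
  (L P : List (Fin N)) (pa : Fin N → Fin N) (uL : Unique L) (uP : Unique P)
  (parent-L : ∀ {l} → l ∈ L → Rooting.parent R l ≡ just (pa l))
  (childless : ∀ {u l} → l ∈ L → Rooting.parent R u ≢ just l)
  (P∌L : ∀ {x} → x ∈ P → x ∉ L) (pa∈P : ∀ {l} → l ∈ L → pa l ∈ P) (r≤ : r ≤ suc (length L))
  where

  open Completion sizes πs j≤s N+j≡n R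
  open Final L P pa uL uP parent-L childless P∌L pa∈P r≤

  -- Any `K` low hosts are enough to place a core vertex greedily, while `t` sets of K + s hosts
  -- cannot cover the low ones. The two requirements bound `K` from below and from above.
  module _ (v₀ : Fin n) (leafOf : ∀ {p} → p ∈ P → ∃[ l ] (l ∈ L × pa l ≡ p))
    (K : ℕ) (lenP : suc (8 * s) + 8 * s ≤ length P) (coreK : length core + 4 * s ≤ K)
    (K≤ : K ≤ length low) (small : t * (K + s) < length low) where

    awayFrom : Fin n → List (Fin n)
    awayFrom b = filter (_∉? nbrs b) low

    Bad? : Decidable (λ b → length (awayFrom b) < K)
    Bad? b = length (awayFrom b) <? K

    W : List (Fin n)
    W = filter Bad? (allFin n)

    -- A host adjacent to j + 1 vertices is the parent of at most j of them, hence a parent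
    -- is found among their own at most j(j + 1) parents.
    length-W : length W ≤ j
    length-W = ≮⇒≥ λ gt → <⇒≱ small (≤-trans (⊆-length low-unique (inCover (trans (length-take (suc j) W) (m≤n⇒m⊓n≡m gt)))) lenCover)
      where
      W′ = take (suc j) W
      uW′ : Unique W′
      uW′ = Unique.take⁺ (suc j) (Unique.filter⁺ Bad? (Unique.allFin⁺ n))
      near : Fin n → List (Fin n)
      near b = awayFrom b ++ ups b
      lenCover : length (concatMap near W′) ≤ t * (K + s)
      lenCover = ≤-trans (length-concatMap-≤ near W′ lenNear)
        (*-monoˡ-≤ (K + s) (≤-trans (≤-reflexive (length-take (suc j) W)) (≤-trans (m⊓n≤m (suc j) (length W)) (s≤s j≤s))))
        where
        lenNear : ∀ {b} → b ∈ W′ → length (near b) ≤ K + s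
        lenNear {b} b∈ = ≤-trans (≤-reflexive (length-++ (awayFrom b)))
          (+-mono-≤ (<⇒≤ (proj₂ (∈-filter⁻ Bad? {xs = allFin n} (take-⊆ (suc j) W b∈))))
            (≤-trans (length-ups b) j≤s))
      inUps : ∀ {q b} → q ∈ low → q ∉ concatMap near W′ → b ∈ W′ → b ∈ ups q
      inUps {q} {b} q∈ q∉ b∈ = go (q ∈? nbrs b)
        where
        go : Dec (q ∈ nbrs b) → b ∈ ups q
        go (no q∉b) = ⊥-elim (q∉ (∈-concatMap near b∈ (∈-++⁺ˡ (∈-filter⁺ (_∉? nbrs b) q∈ q∉b))))
        go (yes q∈b) = fromInj₂ (λ q∈ups → ⊥-elim (q∉ (∈-concatMap near b∈ (∈-++⁺ʳ (awayFrom b) q∈ups)))) (∈nbrs⇒∈ups q∈b)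
      inCover : length W′ ≡ suc j → ∀ {q} → q ∈ low → q ∈ concatMap near W′
      inCover lenW′ {q} q∈ = decidable-stable (q ∈? concatMap near W′) λ q∉ →
        <⇒≱ (≤-reflexive (sym lenW′)) (≤-trans (⊆-length uW′ (inUps q∈ q∉)) (length-ups q))

    open Rest W length-W

    isP? : Decidable (_∈ P)
    isP? = _∈? P

    P-in-core : length P ≤ length (filter isP? core)
    P-in-core = ⊆-length uP (λ p∈ → ∈-filter⁺ isP? (P⊆core p∈) p∈)

    -- `E₁` is placed first. With 8s + 1 parents in it, a host adjacent to at most 4s of them is
    -- non-adjacent to at least 4s + 1. The 8s or more parents left in `E₂` serve the hosts for
    -- which this fails.
    module Split (E₂ E₁ : List (Fin N)) (coreEq : core ≡ E₂ ++ E₁) (lenQ : length (filter isP? E₁) ≡ suc (8 * s)) where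

      Q ps : List (Fin N)
      Q = filter isP? E₁
      ps = filter isP? E₂

      uCore : Unique (E₂ ++ E₁)
      uCore = subst Unique coreEq core-unique

      buCore : AllPairs (λ u v → parent v ≢ just u) (E₂ ++ E₁)
      buCore = subst (AllPairs _) coreEq core-bottomUp

      uE₂ : Unique E₂
      uE₂ = proj₁ (allPairs-++⁻ E₂ uCore)

      uE₁ : Unique E₁
      uE₁ = proj₁ (proj₂ (allPairs-++⁻ E₂ uCore))

      E₂∌E₁ : ∀ {x} → x ∈ E₂ → x ∉ E₁
      E₂∌E₁ x∈ x∈′ = proj₂ (proj₂ (allPairs-++⁻ E₂ uCore)) x∈ x∈′ refl

      lenPs : 8 * s ≤ length ps
      lenPs = +-cancelˡ-≤ (suc (8 * s)) _ _ (begin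
        suc (8 * s) + 8 * s        ≤⟨ lenP ⟩
        length P                   ≤⟨ P-in-core ⟩
        length (filter isP? core)  ≡⟨ cong (length ∘ filter isP?) coreEq ⟩
        length (filter isP? (E₂ ++ E₁)) ≡⟨ trans (cong length (filter-++ isP? E₂ E₁)) (length-++ ps) ⟩
        length ps + length Q       ≡⟨ +-comm (length ps) (length Q) ⟩
        length Q + length ps       ≡⟨ cong (_+ length ps) lenQ ⟩
        suc (8 * s) + length ps    ∎)
        where open ≤-Reasoning

      module Dangerous (f₁ : Fin N → Fin n) (g₁ : Good f₁ E₁) (ok₁ : ∀ {u} → u ∈ E₁ → f₁ u ∈ low) where

        C : List (Fin n)
        C = concatMap (nbrs ∘ f₁) Q

        Danger? : Decidable (λ b → 4 * s < count b C × b ∉ W)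
        Danger? b = (4 * s <? count b C) ×-dec (b ∉? W)

        dangers : List (Fin n)
        dangers = filter Danger? (allFin n)

        dangers⁻ : ∀ {b} → b ∈ dangers → 4 * s < count b C × b ∉ W
        dangers⁻ b∈ = proj₂ (∈-filter⁻ Danger? {xs = allFin n} b∈)

        -- The 8s + 1 parents in `Q` sit on low hosts, so `C` has at most (8s + 1) · 4s entries,
        -- whereas each dangerous host occurs at least 4s + 1 times.
        length-dangers : length dangers ≤ 8 * s
        length-dangers = ≮⇒≥ (λ gt → <⇒≱ (*-monoʳ-< (suc (8 * s)) (n<1+n (4 * s))) (begin
          suc (8 * s) * suc (4 * s)  ≤⟨ *-monoˡ-≤ (suc (4 * s)) gt ⟩
          length dangers * suc (4 * s)     ≤⟨ markov (suc (4 * s)) C (Unique.filter⁺ Danger? (Unique.allFin⁺ n)) (proj₁ ∘ dangers⁻) ⟩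
          length C                   ≤⟨ length-concatMap-≤ (nbrs ∘ f₁) Q
            (λ q∈ → proj₂ (∈low⁻ (ok₁ (proj₁ (∈-filter⁻ isP? {xs = E₁} q∈))))) ⟩
          length Q * (4 * s)         ≡⟨ cong (_* (4 * s)) lenQ ⟩
          suc (8 * s) * (4 * s)      ∎))
          where open ≤-Reasoning

        module Dedicated (ded : Fin N → Maybe (Fin n)) (onto : ∀ {b} → b ∈ dangers → ∃[ p ] (p ∈ ps × ded p ≡ just b))
          (into : ∀ {p b} → ded p ≡ just b → b ∈ dangers) where

          allowed : Maybe (Fin n) → List (Fin n)
          allowed nothing = low
          allowed (just b) = awayFrom b

          allowed-low : ∀ m {h} → h ∈ allowed m → h ∈ low
          allowed-low nothing h∈ = h∈
          allowed-low (just b) h∈ = proj₁ (∈-filter⁻ (_∉? nbrs b) {xs = low} h∈)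

          allowed-unique : ∀ m → Unique (allowed m)
          allowed-unique nothing = low-unique
          allowed-unique (just b) = Unique.filter⁺ _ low-unique

          -- A dangerous host lies outside `W`, so by the choice of `W` at least `K` low hosts are
          -- non-adjacent to it.
          allowed-length : ∀ m → (∀ {b} → m ≡ just b → b ∈ dangers) → K ≤ length (allowed m)
          allowed-length nothing _ = K≤
          allowed-length (just b) b∈ = ≮⇒≥ (λ lt → proj₂ (dangers⁻ (b∈ refl)) (∈-filter⁺ Bad? (∈-allFin b) lt))

          module Placed (f : Fin N → Fin n) (g : Good f base)
            (keep₁ : ∀ {u} → u ∈ E₁ → f u ≡ f₁ u) (ok₂ : ∀ {u} → u ∈ E₂ → f u ∈ allowed (ded u))
            (okRest : ∀ {u} → u ∈ rest → f u ∈ avail) where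

            record Filled (bs : List (Fin n)) : Set where
              field
                f′     : Fin N → Fin n
                D      : List (Fin N)
                good   : Good f′ (D ++ base)
                D-uniq : Unique D
                D-leaf : ∀ {l} → l ∈ D → l ∈ L × pa l ∈ E₂ × ∃[ b ] (b ∈ bs × ded (pa l) ≡ just b)
                keeps  : ∀ {x} → x ∈ base → f′ x ≡ f x
                filled : ∀ {b} → b ∈ bs → b ∈ map f′ (D ++ base)

            fill : ∀ bs → (∀ {b} → b ∈ bs → b ∈ dangers) → Filled bs
            fill [] _ = record { f′ = f ; D = [] ; good = g ; D-uniq = [] ; D-leaf = λ () ; keeps = λ _ → refl ; filled = λ () }
            fill (b ∷ bs) sub = decide (fill bs (sub ∘ there))
              where
              decide : Filled bs → Filled (b ∷ bs)
              decide F = occupy (b ∈? map f′ (D ++ base)) (onto (sub (here refl)))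
                where
                open Filled F
                weaken : ∀ {l} → l ∈ D → l ∈ L × pa l ∈ E₂ × ∃[ c ] (c ∈ b ∷ bs × ded (pa l) ≡ just c)
                weaken l∈ with D-leaf l∈
                ... | l∈L , pa∈ , c , c∈ , eq = l∈L , pa∈ , c , there c∈ , eq
                occupy : Dec (b ∈ map f′ (D ++ base)) → ∃[ p ] (p ∈ ps × ded p ≡ just b) → Filled (b ∷ bs)
                occupy (yes b∈) _ = record { f′ = f′ ; D = D ; good = good ; D-uniq = D-uniq ; D-leaf = weaken ; keeps = keeps
                  ; filled = λ { (here refl) → b∈ ; (there c∈) → filled c∈ } }
                occupy (no b∉) (p , p∈ , dp) = put (leafOf (proj₂ (∈-filter⁻ isP? {xs = E₂} p∈)))
                  where
                  p∈E₂ = proj₁ (∈-filter⁻ isP? {xs = E₂} p∈)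
                  p∈base : p ∈ base
                  p∈base = ∈-++⁺ʳ rest (subst (p ∈_) (sym coreEq) (∈-++⁺ˡ p∈E₂))
                  away : f p ∈ awayFrom b
                  away = subst (λ m → f p ∈ allowed m) dp (ok₂ p∈E₂)
                  unused : ¬ Used (f′ p) b
                  unused used = proj₂ (∈-filter⁻ (_∉? nbrs b) {xs = low} away)
                    (subst (_∈ nbrs b) (keeps p∈base) (Used⇒∈nbrs (Used-sym used)))
                  put : ∃[ l ] (l ∈ L × pa l ≡ p) → Filled (b ∷ bs)
                  put (l , l∈ , pl) = record
                    { f′ = update f′ l b ; D = l ∷ D
                    ; good = place l b good l∉ b∉
                        (λ {w} _ eq → subst (λ w → ¬ Used (f′ w) b)
                          (trans (sym pl) (just-injective (trans (sym (parent-L l∈)) eq))) unused)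
                        (λ _ eq → ⊥-elim (childless l∈ eq))
                    ; D-uniq = All.tabulate (λ x∈ l≡x → l∉D (subst (_∈ D) (sym l≡x) x∈)) ∷ D-uniq
                    ; D-leaf = λ { (here refl) → l∈ , subst (_∈ E₂) (sym pl) p∈E₂ , b , here refl , trans (cong ded pl) dp
                                 ; (there k∈) → weaken k∈ }
                    ; keeps = λ x∈ → trans (old (∈-++⁺ʳ D x∈)) (keeps x∈)
                    ; filled = λ { (here refl) → here (sym (update-≡ f′ l b))
                                 ; (there c∈) → there (map-≗-∈ (update f′ l b) f′ old (filled c∈)) }
                    }
                    where
                    -- If `l` had been placed already, its parent would be dedicated to a filled
                    -- host. That host can only be `b`, which is still vacant.
                    l∉D : l ∉ D
                    l∉D l∈D with D-leaf l∈D
                    ... | _ , _ , c , c∈ , eq = b∉ (filled (subst (_∈ bs)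
                      (just-injective (trans (sym eq) (trans (cong ded pl) dp))) c∈))
                    l∉ : l ∉ D ++ base
                    l∉ l∈′ with ∈-++⁻ D l∈′
                    ... | inj₁ l∈D = l∉D l∈D
                    ... | inj₂ l∈base = dom∌L l∈base l∈
                    old : ∀ {x} → x ∈ D ++ base → update f′ l b x ≡ f′ x
                    old x∈ = update-≢ f′ b (λ x≡l → l∉ (subst (_∈ D ++ base) x≡l x∈))

            okCore : ∀ {u} → u ∈ core → f u ∈ low
            okCore u∈ = go (∈-++⁻ E₂ (subst (_ ∈_) coreEq u∈))
              where
              go : ∀ {u} → u ∈ E₂ ⊎ u ∈ E₁ → f u ∈ low
              go {u} (inj₁ u∈) = allowed-low (ded u) (ok₂ u∈)
              go (inj₂ u∈) = subst (_∈ low) (sym (keep₁ u∈)) (ok₁ u∈)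

            fromFilled : Filled dangers → Placement
            fromFilled F = conclude D W L₀ good D-uniq (proj₁ ∘ D-leaf)
                (λ u∈ → subst (λ h → length (nbrs h) ≤ 4 * s) (sym (keeps (∈-++⁺ʳ rest u∈))) (proj₂ (∈low⁻ (okCore u∈))))
                (λ u∈ → subst (λ h → ¬ Reserved h) (sym (keeps u∈)) (free (∈-++⁻ rest u∈)))
                length-W (Unique.filter⁺ inQ? uL)
                (λ l∈ → let l∈L , q∈ = ∈-filter⁻ inQ? {xs = L} l∈ in
                  l∈L , λ l∈D → E₂∌E₁ (proj₁ (proj₂ (D-leaf l∈D))) (proj₁ (∈-filter⁻ isP? {xs = E₁} q∈)))
                suits
              where
              open Filled F
              inQ? : Decidable (λ l → pa l ∈ Q)
              inQ? l = pa l ∈? Q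
              L₀ = filter inQ? L
              free : ∀ {u} → u ∈ rest ⊎ u ∈ core → ¬ Reserved (f u)
              free (inj₁ u∈) = ≥t⇒free (proj₁ (∈avail⁻ (okRest u∈)))
              free (inj₂ u∈) = ≥t⇒free (proj₁ (∈low⁻ (okCore u∈)))
              -- A vacant host outside `W` is not dangerous, as all dangerous hosts are filled. At
              -- most 4s of the 8s + 1 parents in `Q` are therefore adjacent to it, and each of the
              -- others has a leaf in `L₀`.
              suits : ∀ {z} → z ∉ map f′ (D ++ base) → z ∉ W → 4 * s < length (filter (λ l → z ∉? nbrs (f′ (pa l))) L₀)
              suits {z} z∉ z∉W = +-cancelˡ-≤ (4 * s) _ _ (begin
                4 * s + suc (4 * s)                ≡⟨ eight s ⟩
                suc (8 * s)                        ≡⟨ sym lenQ ⟩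
                length Q                           ≡⟨ sym (length-filter-filter¬ (λ q → z ∈? nbrs (f₁ q)) Q) ⟩
                length (filter (λ q → z ∈? nbrs (f₁ q)) Q) + length away
                  ≤⟨ +-mono-≤ (≤-trans (count-concatMap z (nbrs ∘ f₁) Q) few) lift ⟩
                4 * s + length (filter (λ l → z ∉? nbrs (f′ (pa l))) L₀) ∎)
                where
                open ≤-Reasoning
                away = filter (¬? ∘ (λ q → z ∈? nbrs (f₁ q))) Q
                eight : ∀ s → 4 * s + suc (4 * s) ≡ suc (8 * s)
                eight = solve-∀
                few : count z C ≤ 4 * s
                few = ≮⇒≥ (λ gt → z∉ (filled (∈-filter⁺ Danger? (∈-allFin z) (gt , z∉W))))
                suit? : Decidable (λ l → z ∉ nbrs (f′ (pa l)))
                suit? l = z ∉? nbrs (f′ (pa l))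
                lift : length away ≤ length (filter suit? L₀)
                lift = ≤-trans (⊆-length (Unique.filter⁺ _ (Unique.filter⁺ isP? uE₁)) into-map)
                  (≤-reflexive (length-map pa (filter suit? L₀)))
                  where
                  into-map : ∀ {q} → q ∈ away → q ∈ map pa (filter suit? L₀)
                  into-map {q} q∈ = put (leafOf (proj₂ (∈-filter⁻ isP? {xs = E₁} q∈Q)))
                    where
                    q∈Q = proj₁ (∈-filter⁻ (¬? ∘ (λ q → z ∈? nbrs (f₁ q))) {xs = Q} q∈)
                    z∉q = proj₂ (∈-filter⁻ (¬? ∘ (λ q → z ∈? nbrs (f₁ q))) {xs = Q} q∈)
                    q∈E₁ = proj₁ (∈-filter⁻ isP? {xs = E₁} q∈Q)
                    q∈base : q ∈ base
                    q∈base = ∈-++⁺ʳ rest (subst (q ∈_) (sym coreEq) (∈-++⁺ʳ E₂ q∈E₁))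
                    f′q : f′ q ≡ f₁ q
                    f′q = trans (keeps q∈base) (keep₁ q∈E₁)
                    put : ∃[ l ] (l ∈ L × pa l ≡ q) → q ∈ map pa (filter suit? L₀)
                    put (l , l∈ , pl) = subst (_∈ map pa (filter suit? L₀)) pl (∈-map⁺ pa
                      (∈-filter⁺ suit? (∈-filter⁺ inQ? l∈ (subst (_∈ Q) (sym pl) q∈Q))
                        (subst (λ h → z ∉ nbrs h) (sym (trans (cong f′ pl) f′q)) z∉q)))

            placement : Placement
            placement = fromFilled (fill dangers id)

          placeE₂ : ∃[ f ] (Good f (E₂ ++ E₁) × (∀ {x} → x ∈ E₁ → f x ≡ f₁ x) × (∀ {u} → u ∈ E₂ → f u ∈ allowed (ded u)))
          placeE₂ = placeSegment (λ u → allowed (ded u)) E₂ g₁ uCore buCore (λ w∈ → proj₂ (∈low⁻ (ok₁ w∈)))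
            (λ u → allowed-unique (ded u)) (λ {u} _ h∈ → proj₂ (∈low⁻ (allowed-low (ded u) h∈)))
            (λ {u} _ → ≤-trans (≤-reflexive (cong (λ E → length E + 4 * s) (sym coreEq)))
              (≤-trans coreK (allowed-length (ded u) into)))

          placement : Placement
          placement = fromE₂ placeE₂
            where
            fromE₂ : ∃[ f ] (Good f (E₂ ++ E₁) × (∀ {x} → x ∈ E₁ → f x ≡ f₁ x) × (∀ {u} → u ∈ E₂ → f u ∈ allowed (ded u))) → Placement
            fromE₂ (f₂ , g₂ , keep₂ , ok₂) = fromRest (placeRest (subst (Good f₂) (sym coreEq) g₂)
                (λ u∈ → proj₂ (∈low⁻ (low₂ (∈-++⁻ E₂ (subst (_ ∈_) coreEq u∈))))))
              where
              low₂ : ∀ {u} → u ∈ E₂ ⊎ u ∈ E₁ → f₂ u ∈ low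
              low₂ {u} (inj₁ u∈) = allowed-low (ded u) (ok₂ u∈)
              low₂ (inj₂ u∈) = subst (_∈ low) (sym (keep₂ u∈)) (ok₁ u∈)
              toCore : ∀ {u} → u ∈ E₂ ++ E₁ → u ∈ core
              toCore = subst (_ ∈_) (sym coreEq)
              fromRest : ∃[ f ] (Good f (rest ++ core) × (∀ {x} → x ∈ core → f x ≡ f₂ x) × (∀ {u} → u ∈ rest → f u ∈ avail)) → Placement
              fromRest (f , g , keep , ok) = Placed.placement f g
                (λ u∈ → trans (keep (toCore (∈-++⁺ʳ E₂ u∈))) (keep₂ u∈))
                (λ {u} u∈ → subst (_∈ allowed (ded u)) (sym (keep (toCore (∈-++⁺ˡ u∈)))) (ok₂ u∈))
                ok

        placement : Placement
        placement = go (dedicate dangers ps (Unique.filter⁺ isP? uE₂) (≤-trans length-dangers lenPs))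
          where
          go : Dedication dangers ps → Placement
          go d = Dedicated.placement ded onto into
            where open Dedication d

      placement : Placement
      placement = go (placeSegment (λ _ → low) E₁ {[]} {λ _ → v₀} (record { inj = λ () ; edge = λ () })
          (subst Unique (sym (++-identityʳ E₁)) uE₁)
          (subst (AllPairs _) (sym (++-identityʳ E₁)) (proj₁ (proj₂ (allPairs-++⁻ E₂ buCore))))
          (λ ()) (λ _ → low-unique) (λ _ h∈ → proj₂ (∈low⁻ h∈))
          (λ _ → ≤-trans (+-monoˡ-≤ (4 * s) lenE₁) (≤-trans coreK K≤)))
        where
        lenE₁ : length (E₁ ++ []) ≤ length core
        lenE₁ = ≤-trans (≤-reflexive (cong length (++-identityʳ E₁)))
          (≤-trans (length-++-≤ʳ E₁ {E₂}) (≤-reflexive (cong length (sym coreEq))))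
        go : ∃[ f ] (Good f (E₁ ++ []) × (∀ {x} → x ∈ [] → f x ≡ v₀) × (∀ {u} → u ∈ E₁ → f u ∈ low)) → Placement
        go (f₁ , g₁ , _ , ok₁) = Dangerous.placement f₁ (subst (Good f₁) (++-identityʳ E₁) g₁) ok₁

    placement : Placement
    placement = go (filter-split isP? (suc (8 * s)) core (≤-trans (m≤m+n _ (8 * s)) (≤-trans lenP P-in-core)))
      where
      go : (∃[ E₂ ] ∃[ E₁ ] (core ≡ E₂ ++ E₁ × length (filter isP? E₁) ≡ suc (8 * s))) → Placement
      go (E₂ , E₁ , eq , len) = Split.placement E₂ E₁ eq len

-- Leaves of a rooted tree.

allPairs-trichotomy : {R : A → A → Set} {xs : List A} {x y : A} → AllPairs R xs → x ∈ xs → y ∈ xs →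
  x ≡ y ⊎ R x y ⊎ R y x
allPairs-trichotomy (a ∷ as) (here refl) (here refl) = inj₁ refl
allPairs-trichotomy (a ∷ as) (here refl) (there y∈) = inj₂ (inj₁ (All.lookup a y∈))
allPairs-trichotomy (a ∷ as) (there x∈) (here refl) = inj₂ (inj₂ (All.lookup a x∈))
allPairs-trichotomy (a ∷ as) (there x∈) (there y∈) = allPairs-trichotomy as x∈ y∈

unique-map : (f : A → B) {xs : List A} → (∀ {x y} → x ∈ xs → y ∈ xs → f x ≡ f y → x ≡ y) → Unique xs → Unique (map f xs)
unique-map f inj [] = []
unique-map f {x ∷ xs} inj (x# ∷ u) = All.tabulate fresh ∷ unique-map f (λ p q → inj (there p) (there q)) u
  where
  fresh : ∀ {y} → y ∈ map f xs → f x ≢ y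
  fresh y∈ eq with ∈-map⁻ f y∈
  ... | z , z∈ , refl = All.lookup x# z∈ (inj (here refl) (there z∈) eq)

module RootedLeaves {N : ℕ} {G : Graph N} (R : Rooting G) where
  open Graph G
  open Rooting R

  -- The default value can occur only at the root.
  pa : Fin N → Fin N
  pa u = fromMaybe u (parent u)

  acyclic₂ : ∀ {u v} → parent u ≡ just v → parent v ≢ just u
  acyclic₂ {u} {v} uv vu with allPairs-trichotomy bottomUp (covers u) (covers v)
  ... | inj₁ refl = irrefl refl (parent⇒adj uv)
  ... | inj₂ (inj₁ ¬vu) = ¬vu vu
  ... | inj₂ (inj₂ ¬uv) = ¬uv uv

  parent-pa : ∀ {u} → u ∉ [ root ] → parent u ≡ just (pa u)
  parent-pa {u} u∉ with parent u in eq
  ... | nothing = ⊥-elim (u∉ (here (rootUnique eq)))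
  ... | just _ = refl

  leaf-parent : ∀ {l x} → l ∉ [ root ] → Leaf l → Adj l x → x ≡ pa l
  leaf-parent l∉ leaf lx = leaf-neighbour-unique G leaf lx (parent⇒adj (parent-pa l∉))

  -- A child of a leaf would be its only neighbour and hence also its parent, but the bottom-up
  -- order excludes that two vertices are parents of each other.
  leaf-childless : ∀ {l u} → l ∉ [ root ] → Leaf l → parent u ≢ just l
  leaf-childless l∉ leaf ul with leaf-parent l∉ leaf (symm (parent⇒adj ul))
  ... | refl = acyclic₂ ul (parent-pa l∉)

-- Embedding the next tree under either hypothesis.

module NextTree {n s r : ℕ} (sizes : Sizes n s r) (πs : List (Fin n → Maybe (Fin n)))
  (j≤s : length πs ≤ s) {N : ℕ} (N+j≡n : N + length πs ≡ n) {G : Graph N} (R : Rooting G)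
  (v : Fin n) (v≡j : toℕ v ≡ length πs) (fresh : ∀ {π u} → π ∈ πs → π u ≢ just v) where

  open Completion sizes πs j≤s N+j≡n R
  open RootedLeaves R
  open Graph G using (Leaf; Adj; symm)

  -- No earlier tree has a child below `v`, so only the edge to its parent remains in each of them.
  length-nbrs-v : length (nbrs v) ≤ j
  length-nbrs-v = ≤-trans (≤-reflexive (length-++ (ups v)))
    (≤-trans (+-mono-≤ (length-ups v) (empty (downs v) none)) (≤-reflexive (+-identityʳ j)))
    where
    none : ∀ {u} → u ∉ downs v
    none u∈ with ∈downs⁻ u∈
    ... | π , π∈ , eq = fresh π∈ eq
    empty : ∀ (xs : List (Fin n)) → (∀ {x} → x ∉ xs) → length xs ≤ 0
    empty [] _ = z≤n
    empty (x ∷ xs) ∉xs = ⊥-elim (∉xs (here refl))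

  -- At most n/3 hosts are busy and n ≥ 64t³, so at least 2n/3 - t ≥ 128t³/3 - t hosts are low; the
  -- inequalities are multiplied by 3.
  many-low : ∀ {m} → 3 * m + 3 * t ≤ 128 * (t * (t * t)) → m ≤ length low
  many-low {m} le = *-cancelˡ-≤ 3 (+-cancelʳ-≤ (3 * t + n) _ _ (begin
    3 * m + (3 * t + n)              ≡⟨ sym (+-assoc (3 * m) (3 * t) n) ⟩
    3 * m + 3 * t + n                ≤⟨ +-monoˡ-≤ n le ⟩
    128 * (t * (t * t)) + n          ≡⟨ cong (_+ n) (*-assoc 2 64 (t * (t * t))) ⟩
    2 * (64 * (t * (t * t))) + n     ≤⟨ +-monoˡ-≤ n (*-monoʳ-≤ 2 n-lower) ⟩
    2 * n + n                        ≡⟨ +-comm (2 * n) n ⟩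
    3 * n                            ≤⟨ *-monoʳ-≤ 3 length-low ⟩
    3 * (length low + (t + length busy)) ≡⟨ regroup (length low) t (length busy) ⟩
    3 * length low + (3 * t + length busy * 3) ≤⟨ +-monoʳ-≤ (3 * length low) (+-monoʳ-≤ (3 * t) length-busy) ⟩
    3 * length low + (3 * t + n) ∎))
    where
    open ≤-Reasoning
    regroup : ∀ a t b → 3 * (a + (t + b)) ≡ 3 * a + (3 * t + b * 3)
    regroup = solve-∀

  s-eq : s ≡ 20 + (s ∸ 20)
  s-eq = sym (m+[n∸m]≡n s-pos)

  u = s ∸ 20

  module NonRootLeaves (Ls : List (Fin N)) (uLs : Unique Ls) (leaves : ∀ {l} → l ∈ Ls → Leaf l) where

    L : List (Fin N)
    L = filter (_∉? [ root ]) Ls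

    L⁻ : ∀ {l} → l ∈ L → l ∈ Ls × l ∉ [ root ]
    L⁻ = ∈-filter⁻ (_∉? [ root ]) {xs = Ls}

    uL : Unique L
    uL = Unique.filter⁺ _ uLs

    parent-L : ∀ {l} → l ∈ L → parent l ≡ just (pa l)
    parent-L l∈ = parent-pa (proj₂ (L⁻ l∈))

    childless : ∀ {u l} → l ∈ L → parent u ≢ just l
    childless l∈ = leaf-childless (proj₂ (L⁻ l∈)) (leaves (proj₁ (L⁻ l∈)))

    length-L : length Ls ≤ suc (length L)
    length-L = ≤-trans (length-∉ [ root ] uLs) (≤-reflexive (+-comm (length L) 1))

  fewCase : ManyLeavesNearFew n G → Placement
  fewCase (X , Y , X≤ , Y≥ , near) = go (∃-large-fibre pa (4 * s) P L pa∈P enough)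
    where
    open NonRootLeaves (elements Y) (elements-unique Y) (λ l∈ → proj₁ (near (∈-elements⁻ l∈)))
    -- Withheld leaves are childless, so removing them from `X` loses no parent.
    P = filter (_∉? L) (elements X)
    uP : Unique P
    uP = Unique.filter⁺ _ (elements-unique X)
    P∌L : ∀ {x} → x ∈ P → x ∉ L
    P∌L x∈ = proj₂ (∈-filter⁻ (_∉? L) {xs = elements X} x∈)
    pa∈P : ∀ {l} → l ∈ L → pa l ∈ P
    pa∈P {l} l∈ with near (∈-elements⁻ (proj₁ (L⁻ l∈)))
    ... | leaf , x , x∈ , l∈x = ∈-filter⁺ (_∉? L)
      (subst (_∈ elements X) (leaf-parent (proj₂ (L⁻ l∈)) leaf (symm (∈-neighborhood⁻ G l∈x))) (∈-elements⁺ x∈))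
      (λ pa∈L → childless pa∈L (parent-L l∈))
    r≤ : r ≤ suc (length L)
    r≤ = ≤-trans (manyLeaves (≤-trans Y≥ (≤-reflexive (cong (_^ 3) (sym (length-elements Y)))))) length-L
    P≤ : length P * (4 * s) + 2 ≤ r × length P ≤ 4 * t + 4
    P≤ with fewParents X≤
          | ≤-trans (⊆-length uP (λ x∈ → proj₁ (∈-filter⁻ (_∉? L) {xs = elements X} x∈))) (≤-reflexive (length-elements X))
    ... | p , q | le = ≤-trans (+-monoˡ-≤ 2 (*-monoˡ-≤ (4 * s) le)) p , ≤-trans le q
    -- Of the 2 in `fewParents`, one unit pays for a root that is a leaf, the other makes the
    -- inequality strict.
    enough : length P * (4 * s) < length L
    enough = ≤-pred (≤-trans (≤-reflexive (+-comm 2 _)) (≤-trans (proj₁ P≤) r≤))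
    open Final L P pa uL uP parent-L childless P∌L pa∈P r≤
    room : length core + 4 * s + j ≤ length low
    room = ≤-trans (+-mono-≤ (+-monoˡ-≤ (4 * s) (≤-trans length-core (*-monoʳ-≤ 2 (proj₂ P≤)))) j≤s)
      (many-low (subst (λ s → 3 * (2 * (4 * suc s + 4) + 4 * s + s) + 3 * suc s ≤ 128 * (suc s * (suc s * suc s)))
        (sym s-eq) (slack (128 * (u * (u * u)) + 8064 * (u * u) + 169302 * u + 1184517) (eq u))))
      where
      eq : ∀ u → 3 * (2 * (4 * suc (20 + u) + 4) + 4 * (20 + u) + (20 + u)) + 3 * suc (20 + u)
        + (128 * (u * (u * u)) + 8064 * (u * u) + 169302 * u + 1184517) ≡ 128 * (suc (20 + u) * (suc (20 + u) * suc (20 + u)))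
      eq = solve-∀
    go : ∃[ x ] (x ∈ P × 4 * s < length (filter (λ l → pa l Fin.≟ x) L)) → Placement
    go (x , x∈ , many) = FewParents.placement v v≡j length-nbrs-v x x∈ many room

  independentCase : ManyIndependentLeaves n G → Placement
  independentCase (Y , Y≥ , leaf , indep) =
    Independent.placement sizes πs j≤s N+j≡n R L P pa uL uP parent-L childless P∌L pa∈P r≤
      -- At most r ≤ 18t² parents give a core of at most 36t² vertices, and adjacency forbids 4s
      -- hosts more, so 40t² are enough. On the other side t(40t² + s) stays below the roughly
      -- 128t³/3 low hosts.
      v leafOf (40 * (t * t)) lenP coreK (many-low K≤) (many-low small)
    where
    -- Only r leaves are withheld, which keeps the core quadratic in t however many independent
    -- leaves there are.
    chosen = take r (elements Y)
    chosen⁻ : ∀ {l} → l ∈ chosen → l ∈ elements Y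
    chosen⁻ = take-⊆ r (elements Y)
    open NonRootLeaves chosen (Unique.take⁺ r (elements-unique Y)) (leaf ∘ ∈-elements⁻ ∘ chosen⁻)
    length-chosen : length chosen ≡ r
    length-chosen = trans (length-take r (elements Y)) (m≤n⇒m⊓n≡m
      (manyLeaves (≤-trans Y≥ (≤-reflexive (cong (_^ 3) (sym (length-elements Y)))))))
    P = map pa L
    pa-injective : ∀ {k l} → k ∈ L → l ∈ L → pa k ≡ pa l → k ≡ l
    pa-injective {k} {l} k∈ l∈ eq = decidable-stable (k Fin.≟ l) λ k≢l →
      indep (∈-elements⁻ (chosen⁻ (proj₁ (L⁻ k∈)))) (∈-elements⁻ (chosen⁻ (proj₁ (L⁻ l∈)))) k≢l
        (parent⇒adj (parent-L k∈)) (parent⇒adj (parent-L l∈)) eq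
    uP : Unique P
    uP = unique-map pa pa-injective uL
    leafOf : ∀ {p} → p ∈ P → ∃[ l ] (l ∈ L × pa l ≡ p)
    leafOf p∈ with ∈-map⁻ pa p∈
    ... | l , l∈ , eq = l , l∈ , sym eq
    P∌L : ∀ {x} → x ∈ P → x ∉ L
    P∌L x∈ x∈L with ∈-map⁻ pa x∈
    ... | l , l∈ , refl = childless x∈L (parent-L l∈)
    pa∈P : ∀ {l} → l ∈ L → pa l ∈ P
    pa∈P = ∈-map⁺ pa
    r≤ : r ≤ suc (length L)
    r≤ = ≤-trans (≤-reflexive (sym length-chosen)) length-L
    open Leaves L P pa uL uP parent-L childless P∌L pa∈P r≤
    lenP : suc (8 * s) + 8 * s ≤ length P
    lenP = ≤-trans (≤-pred (≤-trans (≤-trans (slack (16 * (s * s) + 16 * s + 14) (eq s)) r-lower) r≤))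
      (≤-reflexive (sym (length-map pa L)))
      where
      eq : ∀ s → suc (suc (8 * s) + 8 * s) + (16 * (s * s) + 16 * s + 14) ≡ 16 * (suc s * suc s)
      eq = solve-∀
    coreK : length core + 4 * s ≤ 40 * (t * t)
    coreK = begin
      length core + 4 * s          ≤⟨ +-monoˡ-≤ (4 * s) length-core ⟩
      2 * length P + 4 * s         ≡⟨ cong (λ m → 2 * m + 4 * s) (length-map pa L) ⟩
      2 * length L + 4 * s         ≤⟨ +-monoˡ-≤ (4 * s) (*-monoʳ-≤ 2
        (≤-trans (length-filter (_∉? [ root ]) chosen) (≤-reflexive length-chosen))) ⟩
      2 * r + 4 * s                ≤⟨ +-monoˡ-≤ (4 * s) (*-monoʳ-≤ 2 r-upper) ⟩
      2 * (18 * (t * t)) + 4 * s   ≤⟨ slack (4 * (s * s) + 4 * s + 4) (eq s) ⟩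
      40 * (t * t)                 ∎
      where
      open ≤-Reasoning
      eq : ∀ s → 2 * (18 * (suc s * suc s)) + 4 * s + (4 * (s * s) + 4 * s + 4) ≡ 40 * (suc s * suc s)
      eq = solve-∀
    small : 3 * suc (t * (40 * (t * t) + s)) + 3 * t ≤ 128 * (t * (t * t))
    small = subst (λ s → 3 * suc (suc s * (40 * (suc s * suc s) + s)) + 3 * suc s ≤ 128 * (suc s * (suc s * suc s)))
      (sym s-eq) (slack (8 * (u * (u * u)) + 501 * (u * u) + 10458 * u + 72762) (eq u))
      where
      eq : ∀ u → 3 * suc (suc (20 + u) * (40 * (suc (20 + u) * suc (20 + u)) + (20 + u))) + 3 * suc (20 + u)
        + (8 * (u * (u * u)) + 501 * (u * u) + 10458 * u + 72762) ≡ 128 * (suc (20 + u) * (suc (20 + u) * suc (20 + u)))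
      eq = solve-∀
    K≤ : 3 * (40 * (t * t)) + 3 * t ≤ 128 * (t * (t * t))
    K≤ = ≤-trans (+-monoˡ-≤ (3 * t) (*-monoʳ-≤ 3 
      (≤-trans (m≤m+n (40 * (t * t)) s) (≤-trans (m≤n*m (40 * (t * t) + s) t) (n≤1+n _))))) small

  -- `code` is the parent function by which later trees know this one, and `later` ensures that the
  -- reserved hosts still to come have no children in it.
  record NewTree : Set where
    field
      embedding : Embedding G (complete n)
      code      : Fin n → Maybe (Fin n)
      coded     : ∀ {a b} → Embedding.ImageAdj embedding a b → Link code a b
      unused    : ∀ {a b} → Embedding.ImageAdj embedding a b → ¬ Used a b
      later     : ∀ {k a} → j < toℕ k → toℕ k < t → code a ≢ just k

  fromPlacement : Placement → NewTree
  fromPlacement p = record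
    { embedding = record
        { to = to ; injective = injective
        ; preserves = λ uv eq → Graph.irrefl G (injective eq) uv }
    ; code = code ; coded = coded ; unused = unused ; later = later }
    where
    open Placement p
    code : Fin n → Maybe (Fin n)
    code a with Fin.any? (λ u → to u Fin.≟ a)
    ... | yes (u , _) = Maybe.map to (parent u)
    ... | no _ = nothing
    code-to : ∀ {u w} → parent u ≡ just w → code (to u) ≡ just (to w)
    code-to {u} uw with Fin.any? (λ w → to w Fin.≟ to u)
    ... | yes (w , eq) rewrite injective eq | uw = refl
    ... | no ∄ = ⊥-elim (∄ (u , refl))
    coded : ∀ {a b} → (∃[ u ] ∃[ w ] (Adj u w × to u ≡ a × to w ≡ b)) → Link code a b
    coded (u , w , uw , refl , refl) with adj⇒link uw
    ... | inj₁ eq = inj₁ (code-to eq)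
    ... | inj₂ eq = inj₂ (code-to eq)
    unused : ∀ {a b} → (∃[ u ] ∃[ w ] (Adj u w × to u ≡ a × to w ≡ b)) → ¬ Used a b
    unused (u , w , uw , refl , refl) with adj⇒link uw
    ... | inj₁ eq = edges eq
    ... | inj₂ eq = edges eq ∘ Used-sym
    later : ∀ {k a} → j < toℕ k → toℕ k < t → code a ≢ just k
    later {k} {a} j<k k<t eq with Fin.any? (λ u → to u Fin.≟ a)
    ... | yes (u , _) with parent u in uw
    ...   | just w with eq
    ...     | refl = free uw (j<k , k<t)

  newTree : ManyLeavesNearFew n G ⊎ ManyIndependentLeaves n G → NewTree
  newTree (inj₁ few) = fromPlacement (fewCase few)
  newTree (inj₂ ind) = fromPlacement (independentCase ind)

-- Packing the trees one after the other.

module Packing {n s r : ℕ} (sizes : Sizes n s r) (T : (i : Fin (suc s)) → Graph (n ∸ toℕ i))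
  (trees : ∀ i → Graph.IsTree (T i)) (leafy : ∀ i → ManyLeavesNearFew n (T i) ⊎ ManyIndependentLeaves n (T i)) where

  open Sizes sizes

  t≤n : t ≤ n
  t≤n = ≤-trans (≤-trans (m≤m*n t (t * t)) (m≤n*m (t * (t * t)) 64)) n-lower

  -- By `used` the parent functions record every edge taken, so that avoiding them yields
  -- disjointness. The invariant `fresh` says that the hosts from j to t - 1 have no children so
  -- far.
  record Packed (j : ℕ) : Set where
    field
      πs       : List (Fin n → Maybe (Fin n))
      length-πs : length πs ≡ j
      emb      : ∀ i → toℕ i < j → Embedding (T i) (complete n)
      used     : ∀ {i} (i<j : toℕ i < j) {a b} → Embedding.ImageAdj (emb i i<j) a b → Host.Used πs a b
      disjoint : ∀ {i k} (i<j : toℕ i < j) (k<j : toℕ k < j) → i ≢ k → EdgeDisjoint (emb i i<j) (emb k k<j)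
      fresh    : ∀ {π k a} → π ∈ πs → j ≤ toℕ k → toℕ k < t → π a ≢ just k

  step : ∀ {j} → j < t → Packed j → Packed (suc j)
  step {j} j<t packed = extend length-πs
    where
    open Packed packed
    i₀ : Fin t
    i₀ = Fin.fromℕ< j<t
    i₀≡j : toℕ i₀ ≡ j
    i₀≡j = Fin.toℕ-fromℕ< j<t
    v : Fin n
    v = Fin.fromℕ< (≤-trans j<t t≤n)
    v≡j : toℕ v ≡ j
    v≡j = Fin.toℕ-fromℕ< (≤-trans j<t t≤n)
    -- As t ≤ n, the truncated subtraction is exact, and tree j has n - j vertices.
    open NextTree sizes πs (subst (_≤ s) (sym length-πs) (≤-pred j<t))
      (trans (cong₂ (λ a b → n ∸ a + b) i₀≡j length-πs) (m∸n+n≡m (≤-trans (<⇒≤ j<t) t≤n)))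
      (rooting (T i₀) (trees i₀)) v (trans v≡j (sym length-πs))
      (λ π∈ → fresh π∈ (≤-reflexive (sym v≡j)) (≤-<-trans (≤-reflexive v≡j) j<t))
    new : NewTree
    new = newTree (leafy i₀)
    module New = NewTree new
    choose : ∀ {i} → toℕ i < suc j → i ≡ i₀ ⊎ toℕ i < j
    choose {i} i<1+j with m≤n⇒m<n∨m≡n (≤-pred i<1+j)
    ... | inj₁ i<j = inj₂ i<j
    ... | inj₂ i≡j = inj₁ (Fin.toℕ-injective (trans i≡j (sym i₀≡j)))
    pick : ∀ i → i ≡ i₀ ⊎ toℕ i < j → Embedding (T i) (complete n)
    pick i (inj₁ refl) = New.embedding
    pick i (inj₂ i<j) = emb i i<j
    used′ : ∀ {i} (c : i ≡ i₀ ⊎ toℕ i < j) {a b} → Embedding.ImageAdj (pick i c) a b → Host.Used (New.code ∷ πs) a b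
    used′ (inj₁ refl) ab = here (New.coded ab)
    used′ (inj₂ i<j) ab = there (used i<j ab)
    disjoint′ : ∀ {i k} (c : i ≡ i₀ ⊎ toℕ i < j) (d : k ≡ i₀ ⊎ toℕ k < j) → i ≢ k → EdgeDisjoint (pick i c) (pick k d)
    disjoint′ (inj₁ refl) (inj₁ refl) i≢k = ⊥-elim (i≢k refl)
    disjoint′ (inj₁ refl) (inj₂ k<j) _ a b (p , q) = New.unused p (used k<j q)
    disjoint′ (inj₂ i<j) (inj₁ refl) _ a b (p , q) = New.unused q (used i<j p)
    disjoint′ (inj₂ i<j) (inj₂ k<j) i≢k = disjoint i<j k<j i≢k
    extend : length πs ≡ j → Packed (suc j)
    extend eq = record
      { πs = New.code ∷ πs
      ; length-πs = cong suc eq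
      ; emb = λ i i<1+j → pick i (choose i<1+j)
      ; used = λ i<1+j → used′ (choose i<1+j)
      ; disjoint = λ i< k< → disjoint′ (choose i<) (choose k<)
      ; fresh = λ { (here refl) j<k k<t → New.later (subst (_< _) (sym eq) j<k) k<t
                  ; (there π∈) j<k k<t → fresh π∈ (<⇒≤ j<k) k<t } }

  all : ∀ j → j ≤ t → Packed j
  all zero _ = record { πs = [] ; length-πs = refl ; emb = λ _ () ; used = λ () ; disjoint = λ () ; fresh = λ () }
  all (suc j) j<t = step j<t (all j (<⇒≤ j<t))

  packs : Packs T (complete n)
  packs = (λ i → emb i (Fin.toℕ<n i)) , λ i k i≢k → disjoint (Fin.toℕ<n i) (Fin.toℕ<n k) i≢k
    where open Packed (all t ≤-refl)

theorem3 : ∃[ n₀ ] (∀ (n : ℕ) → n₀ ≤ n →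
    ∀ (t : ℕ) → IsQuarterCubeRoot n t →
    (T : (i : Fin t) → Graph (n ∸ toℕ i)) →
    (∀ i → Graph.IsTree (T i)) →
    (∀ i → ManyLeavesNearFew n (T i) ⊎ ManyIndependentLeaves n (T i)) →
    Packs T (complete n))
-- From 84³ ≤ n < (4(t + 1))³ follows t ≥ 21, that is s ≥ 20, as the polynomial estimates in s - 20
-- require.
theorem3 = (4 * 21) ^ 3 , λ n n₀≤n t (lower , upper) → large n t lower upper
    (≤-pred (*-cancelˡ-< 4 21 (suc t) (≰⇒> (λ le → <⇒≱ upper (≤-trans (^-monoˡ-≤ 3 le) n₀≤n)))))
  where
  large : ∀ n t → (4 * t) ^ 3 ≤ n → n < (4 * suc t) ^ 3 → 21 ≤ t →
    (T : (i : Fin t) → Graph (n ∸ toℕ i)) → (∀ i → Graph.IsTree (T i)) →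
    (∀ i → ManyLeavesNearFew n (T i) ⊎ ManyIndependentLeaves n (T i)) → Packs T (complete n)
  large n (suc s) lower upper (s≤s s≥) = Packing.packs (Arith.sizes n s s≥ lower upper)
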